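{- Let $B$ be an oriented graph. If $B$ has the directed forcing property, then $B$ has a homomorphism to $\vec K_2$ and the underlying undirected graph $\overline{B}$ contains a cycle.
   Context: All graphs are finite with non-empty vertex set. An oriented graph is a directed graph obtained from a simple undirected graph by orienting each edge (so there are no loops and at most one of $(x,y),(y,x)$ is an edge). $v(G)$ and $e(G)$ denote the numbers of vertices and edges of $G$. $\vec K_2$ is the oriented graph with two vertices and a single directed edge. $\overline{B}$ denotes the undirected graph obtained from $B$ by forgetting the directions of all edges. A homomorphism of oriented graphs $f:V(B)\to V(G)$ is a map such that $(f(x),f(y))\in E(G)$ whenever $(x,y)\in E(B)$. The homomorphism density $t(B,G)$ is the number of homomorphisms from $B$ to $G$ divided by $v(G)^{v(B)}$; in particular $t(\vec K_2,G)=e(G)/v(G)^2$. For a directed graph $G$ on vertex set $\{1,\dots,n\}$, the associated directed graphon $W_G:[0,1]^2\to[0,1]$ is obtained by partitioning $[0,1]$ into $n$ intervals $I_1,\dots,I_n$ of equal length and setting $W_G(x,y)=1$ if $x\in I_i$, $y\in I_j$ with $(i,j)\in E(G)$, and $W_G(x,y)=0$ otherwise. For a bounded measurable $U:[0,1]^2\to\mathbb{R}$, the cut norm is $\|U\|_\square=\sup_{S,T}\left|\int_{S\times T}U(x,y)\,dx\,dy\right|$, the supremum over measurable $S,T\subset[0,1]$. For $q\in[0,1]$, a sequence of directed graphs $\{G_n\}_{n\in\mathbb{N}}$ is $q$-quasirandom if $\lim_{n\to\infty}\|W_{G_n}-q\|_\square=0$, where $q$ denotes the constant function. An oriented graph $B$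 has the directed forcing property if for every $p\in[0,1]$ and every sequence of oriented graphs $\{G_n\}_{n\in\mathbb{N}}$ with $t(\vec K_2,G_n)\to p/2$ and $t(B,G_n)\to (p/2)^{e(B)}$ as $n\to\infty$, the sequence $\{G_n\}_{n\in\mathbb{N}}$ is $(p/2)$-quasirandom. -}

module Defs where

open import Algebra.Bundles using (CommutativeMonoid; CommutativeRing)
import Algebra.Properties.CommutativeSemigroup as CommutativeSemigroupProperties
import Algebra.Properties.Ring as RingProperties
open import Data.Bool.Base using (if_then_else_)
open import Data.Fin.Base using (Fin; zero; suc; toℕ; inject₁; fromℕ; finToFun)
open import Data.Fin.Properties using (all?)
  renaming (_≟_ to _≟ᶠ_)
open import Data.Integer.Base using (+_)
open import Data.List.Base using (List; length; filter; allFin; cartesianProduct)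
open import Data.Nat.Base as ℕ using (ℕ; zero; suc)
import Data.Nat.Properties as ℕ
open import Data.Product.Base using (Σ-syntax; ∃; ∃-syntax; _×_; _,_; uncurry)
open import Data.Rational.Base as ℚ using (ℚ; 0ℚ; 1ℚ; ½)
import Data.Rational.Properties as ℚ
open import Data.Sum.Base as Sum using (_⊎_; inj₁; inj₂; swap)
open import Data.Vec.Functional using (foldr)
open import Function.Base using (_∘_)
open import Function.Definitions using (Injective)
open import Level using (0ℓ)
open import Relation.Binary.Core using (Rel)
open import Relation.Binary.Definitions
  using (Asymmetric; Symmetric; Irreflexive; Decidable; _Respects_)
open import Relation.Binary.PropositionalEquality
  using (_≡_; _≢_; refl; sym; trans; cong; cong₂; subst; subst₂)
open import Relation.Nullary.Decidable using (Dec; does; _→-dec_; _×-dec_)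
open import Relation.Nullary.Negation using (¬_)
open import Relation.Unary using (Pred; _⊆_)

IsCauchy : (ℕ → ℚ) → Set
IsCauchy x = ∀ ε → 0ℚ ℚ.< ε →
  ∃[ N ] ∀ m n → N ℕ.≤ m → N ℕ.≤ n → ℚ.∣ x m ℚ.- x n ∣ ℚ.≤ ε

-- A Cauchy real; equality is _≈_ below, not _≡_.
record ℝ : Set where
  constructor mkℝ
  field
    approx : ℕ → ℚ
    cauchy : IsCauchy approx

open ℝ public

private
  open RingProperties (CommutativeRing.ring ℚ.+-*-commutativeRing)
    using (⁻¹-anti-homo-//; //-rightDividesˡ; //-rightDividesʳ; x[y-z]≈xy-xz; [y-z]x≈yx-zx)
  open CommutativeSemigroupProperties
    (CommutativeMonoid.commutativeSemigroup ℚ.+-0-commutativeMonoid)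
    using (interchange)

  ½ε>0 : ∀ {ε} → 0ℚ ℚ.< ε → 0ℚ ℚ.< ½ ℚ.* ε
  ½ε>0 {ε} 0<ε = subst (ℚ._< ½ ℚ.* ε) (ℚ.*-zeroʳ ½) (ℚ.*-monoʳ-<-pos ½ 0<ε)

  ½+½ : ∀ ε → ½ ℚ.* ε ℚ.+ ½ ℚ.* ε ≡ ε
  ½+½ ε = trans (sym (ℚ.*-distribʳ-+ ε ½ ½)) (ℚ.*-identityˡ ε)

  telescope : ∀ a b c → (a ℚ.- b) ℚ.+ (b ℚ.- c) ≡ a ℚ.- c
  telescope a b c = trans (sym (ℚ.+-assoc (a ℚ.- b) b (ℚ.- c)))
    (cong (ℚ._- c) (//-rightDividesˡ b a))

  cauchy-const : ∀ a → IsCauchy (λ _ → a)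
  cauchy-const a ε 0<ε = 0 , λ _ _ _ _ →
    subst (ℚ._≤ ε) (sym (cong ℚ.∣_∣ (ℚ.+-inverseʳ a))) (ℚ.<⇒≤ 0<ε)

  cauchy-+ : ∀ x y → IsCauchy x → IsCauchy y → IsCauchy (λ n → x n ℚ.+ y n)
  cauchy-+ x y cx cy ε 0<ε with cx _ (½ε>0 0<ε) | cy _ (½ε>0 0<ε)
  ... | M , hx | N , hy = M ℕ.⊔ N , λ m n p q → begin
    ℚ.∣ (x m ℚ.+ y m) ℚ.- (x n ℚ.+ y n) ∣
      ≡⟨ cong ℚ.∣_∣ (trans
           (cong (x m ℚ.+ y m ℚ.+_) (ℚ.neg-distrib-+ (x n) (y n)))
           (interchange (x m) (y m) (ℚ.- x n) (ℚ.- y n))) ⟩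
    ℚ.∣ (x m ℚ.- x n) ℚ.+ (y m ℚ.- y n) ∣
      ≤⟨ ℚ.∣p+q∣≤∣p∣+∣q∣ (x m ℚ.- x n) (y m ℚ.- y n) ⟩
    ℚ.∣ x m ℚ.- x n ∣ ℚ.+ ℚ.∣ y m ℚ.- y n ∣
      ≤⟨ ℚ.+-mono-≤
           (hx m n (ℕ.≤-trans (ℕ.m≤m⊔n M N) p) (ℕ.≤-trans (ℕ.m≤m⊔n M N) q))
           (hy m n (ℕ.≤-trans (ℕ.m≤n⊔m M N) p) (ℕ.≤-trans (ℕ.m≤n⊔m M N) q)) ⟩
    ½ ℚ.* ε ℚ.+ ½ ℚ.* ε  ≡⟨ ½+½ ε ⟩
    ε ∎
    where open ℚ.≤-Reasoning

  cauchy-neg : ∀ x → IsCauchy x → IsCauchy (λ n → ℚ.- x n)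
  cauchy-neg x cx ε 0<ε with cx ε 0<ε
  ... | N , h = N , λ m n p q →
    subst (ℚ._≤ ε)
      (trans (sym (ℚ.∣-p∣≡∣p∣ (x m ℚ.- x n)))
             (cong ℚ.∣_∣ (ℚ.neg-distrib-+ (x m) (ℚ.- x n))))
      (h m n p q)

  ∣a∣≤∣a-b∣+∣b∣ : ∀ a b → ℚ.∣ a ∣ ℚ.≤ ℚ.∣ a ℚ.- b ∣ ℚ.+ ℚ.∣ b ∣
  ∣a∣≤∣a-b∣+∣b∣ a b = subst (λ c → ℚ.∣ c ∣ ℚ.≤ ℚ.∣ a ℚ.- b ∣ ℚ.+ ℚ.∣ b ∣)
    (//-rightDividesˡ b a)
    (ℚ.∣p+q∣≤∣p∣+∣q∣ (a ℚ.- b) b)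

  ∣a∣-∣b∣≤∣a-b∣ : ∀ a b → ℚ.∣ a ∣ ℚ.- ℚ.∣ b ∣ ℚ.≤ ℚ.∣ a ℚ.- b ∣
  ∣a∣-∣b∣≤∣a-b∣ a b = subst (ℚ.∣ a ∣ ℚ.- ℚ.∣ b ∣ ℚ.≤_)
    (//-rightDividesʳ ℚ.∣ b ∣ ℚ.∣ a ℚ.- b ∣)
    (ℚ.+-monoˡ-≤ (ℚ.- ℚ.∣ b ∣) (∣a∣≤∣a-b∣+∣b∣ a b))

  ∣a-b∣≡∣b-a∣ : ∀ a b → ℚ.∣ a ℚ.- b ∣ ≡ ℚ.∣ b ℚ.- a ∣
  ∣a-b∣≡∣b-a∣ a b = trans (sym (ℚ.∣-p∣≡∣p∣ (a ℚ.- b))) (cong ℚ.∣_∣ (⁻¹-anti-homo-// a b))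

  reverse-triangle : ∀ a b → ℚ.∣ ℚ.∣ a ∣ ℚ.- ℚ.∣ b ∣ ∣ ℚ.≤ ℚ.∣ a ℚ.- b ∣
  reverse-triangle a b with ℚ.∣p∣≡p∨∣p∣≡-p (ℚ.∣ a ∣ ℚ.- ℚ.∣ b ∣)
  ... | inj₁ eq = subst (ℚ._≤ ℚ.∣ a ℚ.- b ∣) (sym eq) (∣a∣-∣b∣≤∣a-b∣ a b)
  ... | inj₂ eq = subst₂ ℚ._≤_
    (sym (trans eq (⁻¹-anti-homo-// ℚ.∣ a ∣ ℚ.∣ b ∣))) (∣a-b∣≡∣b-a∣ b a)
    (∣a∣-∣b∣≤∣a-b∣ b a)

  cauchy-abs : ∀ x → IsCauchy x → IsCauchy (λ n → ℚ.∣ x n ∣)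
  cauchy-abs x cx ε 0<ε with cx ε 0<ε
  ... | N , h = N , λ m n p q → ℚ.≤-trans (reverse-triangle (x m) (x n)) (h m n p q)

  EventuallyBounded : (ℕ → ℚ) → Set
  EventuallyBounded x = ∃[ N ] ∃[ M ] 0ℚ ℚ.< M × (∀ n → N ℕ.≤ n → ℚ.∣ x n ∣ ℚ.≤ M)

  0<1 : 0ℚ ℚ.< 1ℚ
  0<1 = ℚ.positive⁻¹ 1ℚ

  bounded : ∀ x → IsCauchy x → EventuallyBounded x
  bounded x cx with cx 1ℚ 0<1
  ... | N , h = N , 1ℚ ℚ.+ ℚ.∣ x N ∣ ,
    ℚ.+-mono-<-≤ 0<1 (ℚ.0≤∣p∣ (x N)) ,
    λ n p → ℚ.≤-trans (∣a∣≤∣a-b∣+∣b∣ (x n) (x N)) (ℚ.+-monoˡ-≤ ℚ.∣ x N ∣ (h n N p ℕ.≤-refl))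

  cauchy-* : ∀ x y → IsCauchy x → IsCauchy y → IsCauchy (λ n → x n ℚ.* y n)
  cauchy-* x y cx cy ε 0<ε with bounded x cx | bounded y cy
  ... | Nx , A , 0<A , hA | Ny , B , 0<B , hB = result
    where
    open ℚ.≤-Reasoning
    instance
      A-pos : ℚ.Positive A
      A-pos = ℚ.positive 0<A
      B-pos : ℚ.Positive B
      B-pos = ℚ.positive 0<B
      C-pos : ℚ.Positive (A ℚ.+ B)
      C-pos = ℚ.positive (ℚ.+-mono-< 0<A 0<B)
      C-nz : ℚ.NonZero (A ℚ.+ B)
      C-nz = ℚ.pos⇒nonZero (A ℚ.+ B)
      1/C-pos : ℚ.Positive (ℚ.1/ (A ℚ.+ B))
      1/C-pos = ℚ.1/pos⇒pos (A ℚ.+ B)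
      A-nn : ℚ.NonNegative A
      A-nn = ℚ.pos⇒nonNeg A
      B-nn : ℚ.NonNegative B
      B-nn = ℚ.pos⇒nonNeg B
    δ : ℚ
    δ = ℚ.1/ (A ℚ.+ B) ℚ.* ε
    0<δ : 0ℚ ℚ.< δ
    0<δ = subst (ℚ._< δ) (ℚ.*-zeroʳ (ℚ.1/ (A ℚ.+ B))) (ℚ.*-monoʳ-<-pos (ℚ.1/ (A ℚ.+ B)) 0<ε)
    scaled : ∀ u v M → .{{ℚ.NonNegative M}} → ℚ.∣ u ∣ ℚ.≤ M → ℚ.∣ v ∣ ℚ.≤ δ →
             ℚ.∣ u ℚ.* v ∣ ℚ.≤ M ℚ.* δ
    scaled u v M hu hv = begin
      ℚ.∣ u ℚ.* v ∣           ≡⟨ ℚ.∣p*q∣≡∣p∣*∣q∣ u v ⟩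
      ℚ.∣ u ∣ ℚ.* ℚ.∣ v ∣     ≤⟨ ℚ.*-monoʳ-≤-nonNeg ℚ.∣ v ∣ {{ℚ.∣-∣-nonNeg v}} hu ⟩
      M ℚ.* ℚ.∣ v ∣           ≤⟨ ℚ.*-monoˡ-≤-nonNeg M hv ⟩
      M ℚ.* δ ∎
    result : ∃[ N ] ∀ m n → N ℕ.≤ m → N ℕ.≤ n → ℚ.∣ x m ℚ.* y m ℚ.- x n ℚ.* y n ∣ ℚ.≤ ε
    result with cx δ 0<δ | cy δ 0<δ
    ... | Mx , hx | My , hy = (Nx ℕ.⊔ Ny) ℕ.⊔ (Mx ℕ.⊔ My) , λ m n p q → begin
      ℚ.∣ x m ℚ.* y m ℚ.- x n ℚ.* y n ∣
        ≡⟨ cong ℚ.∣_∣ (sym (trans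
             (cong₂ ℚ._+_ (x[y-z]≈xy-xz (x m) (y m) (y n))
               (trans (ℚ.*-comm (y n) (x m ℚ.- x n)) ([y-z]x≈yx-zx (y n) (x m) (x n))))
             (telescope (x m ℚ.* y m) (x m ℚ.* y n) (x n ℚ.* y n)))) ⟩
      ℚ.∣ x m ℚ.* (y m ℚ.- y n) ℚ.+ y n ℚ.* (x m ℚ.- x n) ∣
        ≤⟨ ℚ.∣p+q∣≤∣p∣+∣q∣ (x m ℚ.* (y m ℚ.- y n)) (y n ℚ.* (x m ℚ.- x n)) ⟩
      ℚ.∣ x m ℚ.* (y m ℚ.- y n) ∣ ℚ.+ ℚ.∣ y n ℚ.* (x m ℚ.- x n) ∣
        ≤⟨ ℚ.+-mono-≤
             (scaled (x m) (y m ℚ.- y n) A (hA m (Nx≤ p)) (hy m n (My≤ p) (My≤ q)))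
             (scaled (y n) (x m ℚ.- x n) B (hB n (Ny≤ q)) (hx m n (Mx≤ p) (Mx≤ q))) ⟩
      A ℚ.* δ ℚ.+ B ℚ.* δ
        ≡⟨ sym (ℚ.*-distribʳ-+ δ A B) ⟩
      (A ℚ.+ B) ℚ.* (ℚ.1/ (A ℚ.+ B) ℚ.* ε)
        ≡⟨ sym (ℚ.*-assoc (A ℚ.+ B) (ℚ.1/ (A ℚ.+ B)) ε) ⟩
      (A ℚ.+ B) ℚ.* ℚ.1/ (A ℚ.+ B) ℚ.* ε
        ≡⟨ cong (ℚ._* ε) (ℚ.*-inverseʳ (A ℚ.+ B)) ⟩
      1ℚ ℚ.* ε
        ≡⟨ ℚ.*-identityˡ ε ⟩
      ε ∎
      where
      K L : ℕ
      K = Nx ℕ.⊔ Ny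
      L = Mx ℕ.⊔ My
      Nx≤ : ∀ {m} → K ℕ.⊔ L ℕ.≤ m → Nx ℕ.≤ m
      Nx≤ p = ℕ.≤-trans (ℕ.m≤m⊔n Nx Ny) (ℕ.≤-trans (ℕ.m≤m⊔n K L) p)
      Ny≤ : ∀ {m} → K ℕ.⊔ L ℕ.≤ m → Ny ℕ.≤ m
      Ny≤ p = ℕ.≤-trans (ℕ.m≤n⊔m Nx Ny) (ℕ.≤-trans (ℕ.m≤m⊔n K L) p)
      Mx≤ : ∀ {m} → K ℕ.⊔ L ℕ.≤ m → Mx ℕ.≤ m
      Mx≤ p = ℕ.≤-trans (ℕ.m≤m⊔n Mx My) (ℕ.≤-trans (ℕ.m≤n⊔m K L) p)
      My≤ : ∀ {m} → K ℕ.⊔ L ℕ.≤ m → My ℕ.≤ m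
      My≤ p = ℕ.≤-trans (ℕ.m≤n⊔m Mx My) (ℕ.≤-trans (ℕ.m≤n⊔m K L) p)

infix  4 _≤_ _<_ _≈_
infix  8 -_
infixl 7 _*_
infixl 6 _+_ _-_
infixr 8 _^_

ι : ℚ → ℝ
ι a = mkℝ (λ _ → a) (cauchy-const a)

0ℝ 1ℝ ½ℝ : ℝ
0ℝ = ι 0ℚ
1ℝ = ι 1ℚ
½ℝ = ι ½

_+_ : ℝ → ℝ → ℝ
x + y = mkℝ (λ n → approx x n ℚ.+ approx y n) (cauchy-+ (approx x) (approx y) (cauchy x) (cauchy y))

-_ : ℝ → ℝ
- x = mkℝ (λ n → ℚ.- approx x n) (cauchy-neg (approx x) (cauchy x))

_-_ : ℝ → ℝ → ℝ
x - y = x + (- y)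

_*_ : ℝ → ℝ → ℝ
x * y = mkℝ (λ n → approx x n ℚ.* approx y n) (cauchy-* (approx x) (approx y) (cauchy x) (cauchy y))

∣_∣ : ℝ → ℝ
∣ x ∣ = mkℝ (λ n → ℚ.∣ approx x n ∣) (cauchy-abs (approx x) (cauchy x))

_^_ : ℝ → ℕ → ℝ
x ^ zero  = 1ℝ
x ^ suc k = x * x ^ k

_≤_ : Rel ℝ 0ℓ
x ≤ y = ∀ ε → 0ℚ ℚ.< ε →
  ∃[ N ] ∀ n → N ℕ.≤ n → approx x n ℚ.≤ approx y n ℚ.+ ε

_<_ : Rel ℝ 0ℓ
x < y = ∃[ ε ] 0ℚ ℚ.< ε ×
  ∃[ N ] ∀ n → N ℕ.≤ n → approx x n ℚ.+ ε ℚ.≤ approx y n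

_≈_ : Rel ℝ 0ℓ
x ≈ y = x ≤ y × y ≤ x

∑ : ∀ {n} → (Fin n → ℝ) → ℝ
∑ = foldr _+_ 0ℝ

∑ℚ : ∀ {n} → (Fin n → ℚ) → ℚ
∑ℚ = foldr ℚ._+_ 0ℚ

_ConvergesTo_ : (ℕ → ℝ) → ℝ → Set
x ConvergesTo l = ∀ ε → 0ℚ ℚ.< ε →
  ∃[ N ] ∀ n → N ℕ.≤ n → ∣ x n - l ∣ ≤ ι ε

record BoxSpace : Set₁ where
  field
    Point : Set
    _≋_   : Rel Point 0ℓ
    Cube  : Pred Point 0ℓ
    Box   : Set
    _∈ᵇ_  : Point → Box → Set
    vol   : Box → ℚ

record Interval : Set where
  field
    lower upper : ℚ
    lower≤upper : lower ℚ.≤ upper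

[0,1] : BoxSpace
[0,1] = record
  { Point = ℝ
  ; _≋_   = _≈_
  ; Cube  = λ x → 0ℝ ≤ x × x ≤ 1ℝ
  ; Box   = Interval
  ; _∈ᵇ_  = λ x I → ι (lower I) < x × x < ι (upper I)
  ; vol   = λ I → upper I ℚ.- lower I
  }
  where open Interval

_⊗_ : BoxSpace → BoxSpace → BoxSpace
X ⊗ Y = record
  { Point = X.Point × Y.Point
  ; _≋_   = λ { (x , y) (x′ , y′) → x X.≋ x′ × y Y.≋ y′ }
  ; Cube  = λ { (x , y) → X.Cube x × Y.Cube y }
  ; Box   = X.Box × Y.Box
  ; _∈ᵇ_  = λ { (x , y) (b , c) → x X.∈ᵇ b × y Y.∈ᵇ c }
  ; vol   = λ { (b , c) → X.vol b ℚ.* Y.vol c }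
  }
  where module X = BoxSpace X
        module Y = BoxSpace Y

[0,1]² : BoxSpace
[0,1]² = [0,1] ⊗ [0,1]

module Lebesgue (X : BoxSpace) where
  open BoxSpace X

  -- The Lebesgue outer measure of S is at most c: for every ε > 0, S is
  -- covered by countably many boxes of total volume at most c + ε.
  OuterMeasure≤ : Pred Point 0ℓ → ℝ → Set
  OuterMeasure≤ S c = ∀ ε → 0ℚ ℚ.< ε →
    Σ[ b ∈ (ℕ → Box) ]
      (∀ {x} → S x → ∃[ k ] x ∈ᵇ b k) ×
      (∀ n → ι (∑ℚ {n} (λ k → vol (b (toℕ k)))) ≤ c + ι ε)

  -- Lebesgue's definition: S ⊆ Cube is measurable, of measure m, iff its
  -- outer measure is m and that of its complement in Cube is 1 − m.  The
  -- two upper bounds suffice: outer measure is subadditive and Cube has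
  -- outer measure 1, so neither inequality can be strict.
  record HasMeasure (S : Pred Point 0ℓ) (m : ℝ) : Set where
    field
      inCube     : S ⊆ Cube
      respects   : S Respects _≋_
      outer      : OuterMeasure≤ S m
      complement : OuterMeasure≤ (λ x → Cube x × ¬ S x) (1ℝ - m)

  Measurable : Pred Point 0ℓ → Set
  Measurable S = ∃ (HasMeasure S)

  -- Functions are given by their graphs: U x r says that U takes the value
  -- r at x.  (Step functions are not total functions on the reals
  -- constructively.)
  PartialFunction : Set₁
  PartialFunction = Point → ℝ → Set

  -- Simple functions ∑ₖ loₖ·1_{Aₖ} ≤ U ≤ ∑ₖ hiₖ·1_{Aₖ} on E, where the
  -- measurable sets A₁, …, A_K partition E.  The union is taken classically
  -- (¬ ¬): which piece a real lies in is not decidable.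
  record SimpleBounds (U : PartialFunction) (E : Pred Point 0ℓ) : Set₁ where
    field
      pieces   : ℕ
      A        : Fin pieces → Pred Point 0ℓ
      measure  : Fin pieces → ℝ
      lo hi    : Fin pieces → ℝ
      measured : ∀ k → HasMeasure (A k) (measure k)
      disjoint : ∀ {k l} → k ≢ l → ∀ {x} → A k x → ¬ A l x
      within   : ∀ k → A k ⊆ E
      covers   : ∀ {x} → E x → ¬ ¬ (∃[ k ] A k x)
      bounds   : ∀ {k x r} → A k x → U x r → lo k ≤ r × r ≤ hi k

    lowerSum upperSum : ℝ
    lowerSum = ∑ (λ k → lo k * measure k)
    upperSum = ∑ (λ k → hi k * measure k)

  -- ∫_E U = v, the Lebesgue integral of a bounded function: v is the common
  -- value of the lower and upper integrals, defined by simple functions.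
  HasIntegral : PartialFunction → Pred Point 0ℓ → ℝ → Set₁
  HasIntegral U E v = ∀ ε → 0ℚ ℚ.< ε →
    Σ[ s ∈ SimpleBounds U E ]
      v ≤ SimpleBounds.lowerSum s + ι ε × SimpleBounds.upperSum s ≤ v + ι ε

module L¹ = Lebesgue [0,1]
module L² = Lebesgue [0,1]²

-- ‖U‖_□ ≤ c, i.e. c is an upper bound for the set of numbers |∫_{S×T} U|.
CutNorm≤ : L².PartialFunction → ℝ → Set₁
CutNorm≤ U c = ∀ (S T : Pred ℝ 0ℓ) → L¹.Measurable S → L¹.Measurable T →
  ∀ v → L².HasIntegral U (λ { (x , y) → S x × T y }) v → ∣ v ∣ ≤ c

record UndirectedGraph : Set₁ where
  field
    order       : ℕ
    {{order≢0}} : ℕ.NonZero order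
    Adj         : Rel (Fin order) 0ℓ
    symmetric   : Symmetric Adj
    irreflexive : Irreflexive _≡_ Adj

-- A cycle c₀ c₁ … c_k c₀ on k + 1 ≥ 3 distinct vertices.
record Cycle (H : UndirectedGraph) : Set where
  open UndirectedGraph H
  field
    k         : ℕ
    k≥2       : 2 ℕ.≤ k
    c         : Fin (suc k) → Fin order
    injective : Injective _≡_ _≡_ c
    step      : ∀ (i : Fin k) → Adj (c (inject₁ i)) (c (suc i))
    close     : Adj (c (fromℕ k)) (c zero)

record DirectedGraph : Set₁ where
  infix 4 _⟶_ _⟶?_
  field
    order       : ℕ
    {{order≢0}} : ℕ.NonZero order
    _⟶_         : Rel (Fin order) 0ℓ
    _⟶?_        : Decidable _⟶_

  edges : List (Fin order × Fin order)
  edges = filter (uncurry _⟶?_) (cartesianProduct (allFin order) (allFin order))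

record OrientedGraph : Set₁ where
  field
    digraph : DirectedGraph
  open DirectedGraph digraph public
  field
    asymmetric : Asymmetric _⟶_

open OrientedGraph using (digraph)

v e : OrientedGraph → ℕ
v = OrientedGraph.order
e = length ∘ OrientedGraph.edges

underlying : OrientedGraph → UndirectedGraph
underlying B = record
  { order       = order
  ; Adj         = λ x y → x ⟶ y ⊎ y ⟶ x
  ; symmetric   = swap
  ; irreflexive = λ { refl → Sum.[ (λ h → asymmetric h h) , (λ h → asymmetric h h) ] }
  }
  where open OrientedGraph B

K⃗₂ : OrientedGraph
K⃗₂ = record
  { digraph    = record
    { order = 2
    ; _⟶_   = λ x y → x ≡ zero × y ≡ suc zero
    ; _⟶?_  = λ x y → (x ≟ᶠ zero) ×-dec (y ≟ᶠ suc zero)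
    }
  ; asymmetric = λ { (refl , refl) (() , _) }
  }

module _ (B G : OrientedGraph) where
  private
    module B = OrientedGraph B
    module G = OrientedGraph G

  IsHomomorphism : (Fin (v B) → Fin (v G)) → Set
  IsHomomorphism f = ∀ x y → x B.⟶ y → f x G.⟶ f y

  isHomomorphism? : ∀ f → Dec (IsHomomorphism f)
  isHomomorphism? f = all? λ x → all? λ y → (x B.⟶? y) →-dec (f x G.⟶? f y)

  HomomorphicTo : Set
  HomomorphicTo = ∃ IsHomomorphism

  -- finToFun enumerates the maps V(B) → V(G) bijectively.
  hom : ℕ
  hom = length (filter (λ k → isHomomorphism? (finToFun k)) (allFin (v G ℕ.^ v B)))

  t : ℚ
  t = ℚ._/_ (+ hom) (v G ℕ.^ v B) {{ℕ.m^n≢0 (v G) (v B) {{G.order≢0}}}}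

-- The i-th of n equal intervals partitioning [0,1], counted from 0:
-- [i/n, (i+1)/n), with the last one closed on the right.
Part : ∀ n → .{{ℕ.NonZero n}} → Fin n → Pred ℝ 0ℓ
Part n i x =
  ι (+ toℕ i ℚ./ n) ≤ x ×
  (x < ι (+ suc (toℕ i) ℚ./ n) ⊎ (suc (toℕ i) ≡ n × x ≤ 1ℝ))

module _ (G : DirectedGraph) where
  open DirectedGraph G

  W : L².PartialFunction
  W (x , y) r = ∃[ i ] ∃[ j ] Part order i x × Part order j y ×
    r ≈ (if does (i ⟶? j) then 1ℝ else 0ℝ)

_−const_ : L².PartialFunction → ℝ → L².PartialFunction
(U −const q) z r = ∃[ w ] U z w × r ≈ w - q

-- lim ‖W_{Gₙ} − q‖_□ = 0, phrased with upper bounds so that the supremum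
-- need not be constructed.
Quasirandom : ℝ → (ℕ → DirectedGraph) → Set₁
Quasirandom q G = ∀ ε → 0ℚ ℚ.< ε →
  ∃[ N ] ∀ n → N ℕ.≤ n → CutNorm≤ (W (G n) −const q) (ι ε)

DirectedForcing : OrientedGraph → Set₁
DirectedForcing B =
  ∀ (p : ℝ) → 0ℝ ≤ p → p ≤ 1ℝ → ∀ (G : ℕ → OrientedGraph) →
  (λ n → ι (t K⃗₂ (G n))) ConvergesTo (p * ½ℝ) →
  (λ n → ι (t B (G n))) ConvergesTo ((p * ½ℝ) ^ e B) →
  Quasirandom (p * ½ℝ) (λ n → digraph (G n))

{-# OPTIONS --safe #-}

-- If a fixed positive proportion a of the vertices spans no edge, then
-- W − q integrates to −q a² over [0,a)², so a sequence of such graphs is not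
-- q-quasirandom for q > 0.  Hence B is not forcing as soon as such a sequence
-- has edge density q and B-density (in the limit) q^e(B).
--
-- If B̄ is acyclic, the constant sequence C⃗₃ does this with q = 1/3: adding to
-- a forest an edge between two components divides the number of
-- homomorphisms to C⃗₃ by exactly 3, since rotating the images of one
-- component permutes the three possible offsets along the new edge.
--
-- If B has a directed path x → y → z, we interpolate at constant edge density
-- q between a blow-up of the bipartite double cover of B, which receives no
-- homomorphism from B, and a blow-up of B, padded with isolated vertices.
-- Since y has degree at least 2, fewer than 2 e(B) vertices of B are not
-- isolated, so with enough padding the latter has B-density at least q^e(B).
-- With blow-up factor k one step changes the B-density by at most v(B)/k, so
-- some intermediate graph has B-density within v(B)/k of q^e(B).

module Submission where

open import Defs
open import Data.Product.Base using (_×_)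

import Algebra.Properties.CommutativeMonoid.Sum as CommutativeMonoidSum
import Algebra.Properties.Semiring.Sum as SemiringSum
open import Data.Bool.Base using (Bool; true; false; if_then_else_)
open import Data.Fin.Base
  using (Fin; zero; suc; toℕ; inject₁; fromℕ; _↑ˡ_; _↑ʳ_; combine; remQuot; finToFun)
import Data.Fin.Properties as Fin
import Data.Integer.Base as ℤ
open import Data.Integer.Base using (+_; -[1+_])
import Data.Integer.Properties as ℤ
open import Data.List.Base as List
  using (List; []; _∷_; length; filter; allFin; tabulate; cartesianProduct; map; _++_)
open import Data.List.Membership.Propositional using (_∈_)
open import Data.List.Membership.Propositional.Properties
  using (∈-allFin; ∈-cartesianProduct⁺; ∈-filter⁺; ∈-filter⁻)
import Data.List.Properties as List
open import Data.List.Relation.Unary.All as All using (All; []; _∷_)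
open import Data.List.Relation.Unary.AllPairs using ([]; _∷_)
open import Data.List.Relation.Unary.Any using (here; there)
open import Data.List.Relation.Unary.Unique.Propositional using (Unique)
import Data.List.Relation.Unary.Unique.Propositional.Properties as Unique
open import Data.Nat.Base as ℕ using (ℕ; zero; suc)
import Data.Nat.Properties as ℕ
import Data.Nat.Solver as ℕSolver
open import Data.Product.Base using (∃-syntax; _,_; proj₁; proj₂; swap; uncurry)
open import Data.Rational.Base as ℚ using (ℚ; 0ℚ; 1ℚ; ½)
import Data.Rational.Properties as ℚ
import Data.Rational.Solver as ℚSolver
import Data.Rational.Unnormalised.Base as ℚᵘ
import Data.Rational.Unnormalised.Properties as ℚᵘ
open import Data.Sum.Base as Sum using (_⊎_; inj₁; inj₂)
import Data.Vec.Functional as Vec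
open import Function.Base using (_∘_; id)
open import Function.Bundles using (mk⇔)
open import Function.Definitions using (Injective)
open import Level using (0ℓ)
open import Relation.Binary.Construct.Closure.Equivalence as EqC using (EqClosure)
open import Relation.Binary.Construct.Closure.ReflexiveTransitive using (_◅_; _◅◅_)
  renaming (ε to trivial)
open import Relation.Binary.Construct.Closure.Symmetric using (SymClosure; fwd; bwd)
open import Relation.Binary.Core using (Rel)
open import Relation.Binary.PropositionalEquality
open import Relation.Nullary.Decidable
  using (Dec; yes; no; does; dec-true; dec-false; does-⇔; _×-dec_; _⊎-dec_; _→-dec_)
open import Relation.Nullary.Negation using (¬_; contradiction)
open import Relation.Unary using (Pred; Decidable)

open SemiringSum ℕ.+-*-semiring
  using (sum; sum-cong-≗; ∑-comm; ∑-distrib-+; *-distribˡ-sum; *-distribʳ-sum)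
open CommutativeMonoidSum ℕ.*-1-commutativeMonoid using ()
  renaming (sum to product; sum-cong-≗ to product-cong; ∑-distrib-+ to product-distrib-*)
open ℚSolver.+-*-Solver using (solve; _:+_; _:*_; _:-_; :-_; _:=_; con)
open ℕSolver.+-*-Solver using ()
  renaming (solve to solveℕ; _:+_ to _⊕_; _:*_ to _⊛_; _:=_ to _⊜_; con to lit)

-- Inequalities between reals and rationals

0≤-+ : ∀ {p q} → 0ℚ ℚ.≤ p → 0ℚ ℚ.≤ q → 0ℚ ℚ.≤ p ℚ.+ q
0≤-+ = ℚ.+-mono-≤

0≤-* : ∀ {p q} → 0ℚ ℚ.≤ p → 0ℚ ℚ.≤ q → 0ℚ ℚ.≤ p ℚ.* q
0≤-* {p} {q} 0≤p 0≤q = ℚ.nonNegative⁻¹ (p ℚ.* q)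
  {{ℚ.nonNeg*nonNeg⇒nonNeg p {{ℚ.nonNegative 0≤p}} q {{ℚ.nonNegative 0≤q}}}}

0<-* : ∀ {p q} → 0ℚ ℚ.< p → 0ℚ ℚ.< q → 0ℚ ℚ.< p ℚ.* q
0<-* {p} {q} 0<p 0<q = ℚ.positive⁻¹ (p ℚ.* q)
  {{ℚ.pos*pos⇒pos p {{ℚ.positive 0<p}} q {{ℚ.positive 0<q}}}}

≤-from-gap : ∀ {p q} r → 0ℚ ℚ.≤ r → q ≡ p ℚ.+ r → p ℚ.≤ q
≤-from-gap {p} r 0≤r refl = subst (ℚ._≤ p ℚ.+ r) (ℚ.+-identityʳ p) (ℚ.+-monoʳ-≤ p 0≤r)

<-from-gap : ∀ {p q} r → 0ℚ ℚ.< r → q ≡ p ℚ.+ r → p ℚ.< q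
<-from-gap {p} r 0<r refl = subst (ℚ._< p ℚ.+ r) (ℚ.+-identityʳ p) (ℚ.+-monoʳ-< p 0<r)

≤⇒0≤gap : ∀ {p q} → p ℚ.≤ q → 0ℚ ℚ.≤ q ℚ.- p
≤⇒0≤gap {p} {q} p≤q = subst (ℚ._≤ q ℚ.- p) (ℚ.+-inverseʳ p) (ℚ.+-monoˡ-≤ (ℚ.- p) p≤q)

<⇒0<gap : ∀ {p q} → p ℚ.< q → 0ℚ ℚ.< q ℚ.- p
<⇒0<gap {p} {q} p<q = subst (ℚ._< q ℚ.- p) (ℚ.+-inverseʳ p) (ℚ.+-monoˡ-< (ℚ.- p) p<q)

≤∣_∣ : ∀ p → p ℚ.≤ ℚ.∣ p ∣
≤∣ p ∣ with ℚ.≤-total 0ℚ p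
... | inj₁ 0≤p = ℚ.≤-reflexive (sym (ℚ.0≤p⇒∣p∣≡p 0≤p))
... | inj₂ p≤0 = ℚ.≤-trans p≤0 (ℚ.0≤∣p∣ p)

¼ : ℚ
¼ = + 1 ℚ./ 4

0<½* : ∀ {p} → 0ℚ ℚ.< p → 0ℚ ℚ.< ½ ℚ.* p
0<½* = 0<-* (ℚ.positive⁻¹ ½)

-- Cotransitivity of the order, the constructive substitute for trichotomy.
rational-cut : ∀ {a b} → a ℚ.< b → ∀ x → ι a < x ⊎ x < ι b
rational-cut {a} {b} a<b x = split (cauchy x η 0<η)
  where
  -- A quarter of the gap is `η`. The approximant at `N` lies on one side of the midpoint `m`, later
  -- ones stay within `η` of it, and a margin `η` to the endpoint remains.
  η m : ℚ
  η = ¼ ℚ.* (b ℚ.- a)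
  m = a ℚ.+ (η ℚ.+ η)
  0<η : 0ℚ ℚ.< η
  0<η = 0<-* (ℚ.positive⁻¹ ¼) (<⇒0<gap a<b)
  split : (∃[ N ] ∀ i j → N ℕ.≤ i → N ℕ.≤ j → ℚ.∣ approx x i ℚ.- approx x j ∣ ℚ.≤ η) →
          ι a < x ⊎ x < ι b
  split (N , near) with ℚ.≤-total m (approx x N)
  ... | inj₁ m≤ = inj₁ (η , 0<η , N , λ n N≤n →
    let close = ℚ.≤-trans ≤∣ approx x N ℚ.- approx x n ∣ (near N n ℕ.≤-refl N≤n) in
    ≤-from-gap _ (0≤-+ (≤⇒0≤gap m≤) (≤⇒0≤gap close))
      (solve 4 (λ a η s t → t := (a :+ η) :+ ((s :- (a :+ (η :+ η))) :+ (η :- (s :- t))))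
        refl a η (approx x N) (approx x n)))
  ... | inj₂ ≤m = inj₂ (η , 0<η , N , λ n N≤n →
    let close = ℚ.≤-trans ≤∣ approx x n ℚ.- approx x N ∣ (near n N N≤n ℕ.≤-refl) in
    ≤-from-gap _ (0≤-+ (≤⇒0≤gap ≤m) (≤⇒0≤gap close))
      (solve 4 (λ a b s t → let η = con ¼ :* (b :- a) in
          b := (t :+ η) :+ (((a :+ (η :+ η)) :- s) :+ (η :- (t :- s))))
        refl a b (approx x N) (approx x n)))

ι-mono-≤ : ∀ {a b} → a ℚ.≤ b → ι a ≤ ι b
ι-mono-≤ {a} {b} a≤b ε 0<ε = 0 , λ _ _ →
  ≤-from-gap _ (0≤-+ (≤⇒0≤gap a≤b) (ℚ.<⇒≤ 0<ε))
    (solve 3 (λ a b ε → b :+ ε := a :+ ((b :- a) :+ ε)) refl a b ε)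

ι-<-≤-trans : ∀ {a b} x → a ℚ.< b → ι b ≤ x → ι a < x
ι-<-≤-trans {a} {b} x a<b b≤x with b≤x _ (0<½* (<⇒0<gap a<b))
... | N , h = ½ ℚ.* (b ℚ.- a) , 0<½* (<⇒0<gap a<b) , N , λ n N≤n →
  ≤-from-gap _ (≤⇒0≤gap (h n N≤n))
    (solve 3 (λ a b t → let η = con ½ :* (b :- a) in t := (a :+ η) :+ ((t :+ η) :- b))
      refl a b (approx x n))

ι-≤-<-trans : ∀ {a b} x → x ≤ ι a → a ℚ.< b → x < ι b
ι-≤-<-trans {a} {b} x x≤a a<b with x≤a _ (0<½* (<⇒0<gap a<b))
... | N , h = ½ ℚ.* (b ℚ.- a) , 0<½* (<⇒0<gap a<b) , N , λ n N≤n →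
  ≤-from-gap _ (≤⇒0≤gap (h n N≤n))
    (solve 3 (λ a b t → let η = con ½ :* (b :- a) in b := (t :+ η) :+ ((a :+ η) :- t))
      refl a b (approx x n))

<-≤-ι-trans : ∀ {a b} x → x < ι a → a ℚ.≤ b → x ≤ ι b
<-≤-ι-trans {a} {b} x (η , 0<η , N , h) a≤b ε 0<ε = N , λ n N≤n →
  ≤-from-gap _ (0≤-+ (≤⇒0≤gap (h n N≤n)) (0≤-+ (≤⇒0≤gap a≤b) (0≤-+ (ℚ.<⇒≤ 0<η) (ℚ.<⇒≤ 0<ε))))
    (solve 5 (λ t a b η ε → b :+ ε := t :+ ((a :- (t :+ η)) :+ ((b :- a) :+ (η :+ ε))))
      refl (approx x n) a b η ε)

ι-≤-<⇒< : ∀ {r s} x → ι r ≤ x → x < ι s → r ℚ.< s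
ι-≤-<⇒< {r} {s} x r≤x (η , 0<η , M , below) with r≤x _ (0<½* 0<η)
... | N , above =
  let n = M ℕ.⊔ N
      lower = above n (ℕ.m≤n⊔m M N)
      upper = below n (ℕ.m≤m⊔n M N) in
  <-from-gap _ (ℚ.+-mono-≤-< (≤⇒0≤gap lower) (ℚ.+-mono-≤-< (≤⇒0≤gap upper) (0<½* 0<η)))
    (solve 4 (λ r s t η → s := r :+ (((t :+ con ½ :* η) :- r) :+ ((s :- (t :+ η)) :+ con ½ :* η)))
      refl r s (approx x n) η)

≤-respˡ-≈ : ∀ x y z → x ≈ y → x ≤ z → y ≤ z
≤-respˡ-≈ x y z (_ , y≤x) x≤z ε 0<ε with y≤x _ (0<½* 0<ε) | x≤z _ (0<½* 0<ε)
... | M , f | N , g = M ℕ.⊔ N , λ n p →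
  ≤-from-gap _ (0≤-+ (≤⇒0≤gap (f n (ℕ.≤-trans (ℕ.m≤m⊔n M N) p)))
                     (≤⇒0≤gap (g n (ℕ.≤-trans (ℕ.m≤n⊔m M N) p))))
    (solve 4 (λ x y z ε → z :+ ε := y :+ (((x :+ con ½ :* ε) :- y) :+ ((z :+ con ½ :* ε) :- x)))
      refl (approx x n) (approx y n) (approx z n) ε)

<-respˡ-≈ : ∀ x y z → x ≈ y → x < z → y < z
<-respˡ-≈ x y z (_ , y≤x) (η , 0<η , N , g) with y≤x _ (0<½* 0<η)
... | M , f = ½ ℚ.* η , 0<½* 0<η , M ℕ.⊔ N , λ n p →
  ≤-from-gap _ (0≤-+ (≤⇒0≤gap (f n (ℕ.≤-trans (ℕ.m≤m⊔n M N) p)))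
                     (≤⇒0≤gap (g n (ℕ.≤-trans (ℕ.m≤n⊔m M N) p))))
    (solve 4 (λ x y z η → z := (y :+ con ½ :* η) :+ (((x :+ con ½ :* η) :- y) :+ (z :- (x :+ η))))
      refl (approx x n) (approx y n) (approx z n) η)

≤-respʳ-≈ : ∀ x y z → y ≈ z → x ≤ y → x ≤ z
≤-respʳ-≈ x y z (y≤z , _) x≤y ε 0<ε with y≤z _ (0<½* 0<ε) | x≤y _ (0<½* 0<ε)
... | M , f | N , g = M ℕ.⊔ N , λ n p →
  ≤-from-gap _ (0≤-+ (≤⇒0≤gap (f n (ℕ.≤-trans (ℕ.m≤m⊔n M N) p)))
                     (≤⇒0≤gap (g n (ℕ.≤-trans (ℕ.m≤n⊔m M N) p))))
    (solve 4 (λ x y z ε → z :+ ε := x :+ (((z :+ con ½ :* ε) :- y) :+ ((y :+ con ½ :* ε) :- x)))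
      refl (approx x n) (approx y n) (approx z n) ε)

-- Lebesgue measure of an initial block

module _ (X : BoxSpace) where
  open BoxSpace X
  open Lebesgue X

  pairThen : Box → Box → Box → ℕ → Box
  pairThen z b c zero          = b
  pairThen z b c (suc zero)    = c
  pairThen z b c (suc (suc _)) = z

  ∑-vol-null : ∀ z → vol z ≡ 0ℚ → ∀ n → ∑ℚ {n} (λ _ → vol z) ≡ 0ℚ
  ∑-vol-null z null zero    = refl
  ∑-vol-null z null (suc n) = cong₂ ℚ._+_ null (∑-vol-null z null n)

  -- `OuterMeasure≤` wants an infinite sequence of boxes with every partial sum bounded. The two
  -- boxes are continued by copies of a null box, so every partial sum is at most the total. The
  -- bound is asked of each approximant of `c`, which gives the inequality of reals.
  covered-by-two : ∀ {S : Pred Point 0ℓ} c ε (z b₁ b₂ : Box) →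
    vol z ≡ 0ℚ → 0ℚ ℚ.≤ vol b₁ → 0ℚ ℚ.≤ vol b₂ →
    (∀ {x} → S x → x ∈ᵇ b₁ ⊎ x ∈ᵇ b₂) →
    (∀ n → vol b₁ ℚ.+ vol b₂ ℚ.≤ approx c n ℚ.+ ε) →
    ∃[ b ] (∀ {x} → S x → ∃[ k ] x ∈ᵇ b k) ×
           (∀ n → ι (∑ℚ {n} (λ k → vol (b (toℕ k)))) ≤ c + ι ε)
  covered-by-two {S} c ε z b₁ b₂ null 0≤b₁ 0≤b₂ cover total =
    pairThen z b₁ b₂ , covers , λ n η 0<η → 0 , λ m _ →
      ℚ.≤-trans (partial n) (ℚ.≤-trans (total m)
        (≤-from-gap η (ℚ.<⇒≤ 0<η) refl))
    where
    covers : ∀ {x} → S x → ∃[ k ] x ∈ᵇ pairThen z b₁ b₂ k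
    covers s with cover s
    ... | inj₁ x∈b₁ = 0 , x∈b₁
    ... | inj₂ x∈b₂ = 1 , x∈b₂
    partial : ∀ n → ∑ℚ {n} (λ k → vol (pairThen z b₁ b₂ (toℕ k))) ℚ.≤ vol b₁ ℚ.+ vol b₂
    partial zero          = 0≤-+ 0≤b₁ 0≤b₂
    partial (suc zero)    = ℚ.+-monoʳ-≤ (vol b₁) 0≤b₂
    partial (suc (suc n)) = ℚ.≤-reflexive (cong (vol b₁ ℚ.+_)
      (trans (cong (vol b₂ ℚ.+_) (∑-vol-null z null n)) (ℚ.+-identityʳ (vol b₂))))

-- Thickening the planar covers below by δ costs terms linear and quadratic in δ. With δ at most 1
-- the quadratic ones are absorbed, and the excess is at most 11δ, so 16 is a generous constant.
slack : ∀ {ε} → 0ℚ ℚ.< ε → ∃[ δ ] 0ℚ ℚ.< δ × δ ℚ.≤ 1ℚ × + 16 ℚ./ 1 ℚ.* δ ℚ.≤ ε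
slack {ε} 0<ε with ℚ.≤-total ε 1ℚ
... | inj₁ ε≤1 = (+ 1 ℚ./ 16) ℚ.* ε , 0<-* (ℚ.positive⁻¹ (+ 1 ℚ./ 16)) 0<ε ,
  ≤-from-gap _ (0≤-+ (≤⇒0≤gap ε≤1) (0≤-* (ℚ.nonNegative⁻¹ (+ 15 ℚ./ 16)) (ℚ.<⇒≤ 0<ε)))
    (solve 1 (λ ε →
       con 1ℚ := con (+ 1 ℚ./ 16) :* ε :+ ((con 1ℚ :- ε) :+ con (+ 15 ℚ./ 16) :* ε)) refl ε) ,
  ℚ.≤-reflexive (solve 1 (λ ε → con (+ 16 ℚ./ 1) :* (con (+ 1 ℚ./ 16) :* ε) := ε) refl ε)
... | inj₂ 1≤ε = + 1 ℚ./ 16 , ℚ.positive⁻¹ (+ 1 ℚ./ 16) ,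
  ≤-from-gap (+ 15 ℚ./ 16) (ℚ.nonNegative⁻¹ (+ 15 ℚ./ 16)) refl , 1≤ε

interval : ∀ {a b} → a ℚ.≤ b → Interval
interval {a} {b} a≤b = record { lower = a ; upper = b ; lower≤upper = a≤b }

nullInterval : Interval
nullInterval = interval (ℚ.≤-refl {0ℚ})

module InitialBlock {a : ℚ} (0<a : 0ℚ ℚ.< a) (a≤1 : a ℚ.≤ 1ℚ) where

  0≤a : 0ℚ ℚ.≤ a
  0≤a = ℚ.<⇒≤ 0<a

  0≤1-a : 0ℚ ℚ.≤ 1ℚ ℚ.- a
  0≤1-a = ≤⇒0≤gap a≤1

  -- The block is half-open at `a`, so that a part starting at i/n can meet it only if i/n < a.
  Initial : Pred ℝ 0ℓ
  Initial x = 0ℝ ≤ x × x < ι a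

  module Cover {δ : ℚ} (0<δ : 0ℚ ℚ.< δ) where

    0≤δ : 0ℚ ℚ.≤ δ
    0≤δ = ℚ.<⇒≤ 0<δ

    -- Covers of [0,a), [a,1] and [0,1]. Boxes are open, hence the overshoot by δ; only `below` may
    -- end exactly at `a`.
    below above whole : Interval
    below = interval {ℚ.- δ} {a} (≤-from-gap (a ℚ.+ δ) (0≤-+ 0≤a 0≤δ)
      (solve 2 (λ a δ → a := (:- δ) :+ (a :+ δ)) refl a δ))
    above = interval {a ℚ.- δ} {1ℚ ℚ.+ δ} (≤-from-gap ((1ℚ ℚ.- a) ℚ.+ (δ ℚ.+ δ))
      (0≤-+ 0≤1-a (0≤-+ 0≤δ 0≤δ))
      (solve 2 (λ a δ → con 1ℚ :+ δ := (a :- δ) :+ ((con 1ℚ :- a) :+ (δ :+ δ))) refl a δ))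
    whole = interval {ℚ.- δ} {1ℚ ℚ.+ δ} (≤-from-gap (1ℚ ℚ.+ (δ ℚ.+ δ))
      (0≤-+ (ℚ.nonNegative⁻¹ 1ℚ) (0≤-+ 0≤δ 0≤δ))
      (solve 1 (λ δ → con 1ℚ :+ δ := (:- δ) :+ (con 1ℚ :+ (δ :+ δ))) refl δ))

    open BoxSpace [0,1] using (_∈ᵇ_; vol)

    -δ<0 : ℚ.- δ ℚ.< 0ℚ
    -δ<0 = <-from-gap δ 0<δ (sym (ℚ.+-inverseˡ δ))

    1<1+δ : 1ℚ ℚ.< 1ℚ ℚ.+ δ
    1<1+δ = <-from-gap δ 0<δ refl

    ∈whole : ∀ x → 0ℝ ≤ x → x ≤ 1ℝ → x ∈ᵇ whole
    ∈whole x 0≤x x≤1 = ι-<-≤-trans x -δ<0 0≤x , ι-≤-<-trans x x≤1 1<1+δ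

    ∈below : ∀ x → Initial x → x ∈ᵇ below
    ∈below x (0≤x , x<a) = ι-<-≤-trans x -δ<0 0≤x , x<a

    -- A real cannot be compared with `a` by a decision, but the overlap of the two alternatives
    -- between a - δ and a lets cotransitivity choose one.
    above-or-initial : ∀ x → 0ℝ ≤ x → x ≤ 1ℝ → x ∈ᵇ above ⊎ Initial x
    above-or-initial x 0≤x x≤1 =
      Sum.map (_, ι-≤-<-trans x x≤1 1<1+δ) (0≤x ,_) (rational-cut a-δ<a x)
      where
      a-δ<a : a ℚ.- δ ℚ.< a
      a-δ<a = <-from-gap δ 0<δ (solve 2 (λ a δ → a := (a :- δ) :+ δ) refl a δ)

    vol≥0 : ∀ I → 0ℚ ℚ.≤ vol I
    vol≥0 I = ≤⇒0≤gap (Interval.lower≤upper I)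

  initial-measure : L¹.HasMeasure Initial (ι a)
  initial-measure = record
    { inCube     = λ {x} (0≤x , x<a) → 0≤x , <-≤-ι-trans x x<a a≤1
    ; respects   = λ {x} {y} x≈y (0≤x , x<a) →
        ≤-respʳ-≈ 0ℝ x y x≈y 0≤x , <-respˡ-≈ x y (ι a) x≈y x<a
    ; outer      = λ ε 0<ε → let open Cover 0<ε in
        covered-by-two [0,1] (ι a) ε nullInterval below nullInterval refl (vol≥0 below) ℚ.≤-refl
          (λ {x} s → inj₁ (∈below x s))
          (λ _ → ℚ.≤-reflexive (solve 2 (λ a ε → (a :- (:- ε)) :+ con 0ℚ := a :+ ε) refl a ε))
    -- `above` overshoots [a,1] by δ at both ends, so δ is half of ε.
    ; complement = λ ε 0<ε → let open Cover (0<½* 0<ε) in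
        covered-by-two [0,1] (1ℝ - ι a) ε nullInterval above nullInterval refl
          (vol≥0 above) ℚ.≤-refl
          (λ {x} ((0≤x , x≤1) , ¬s) →
            inj₁ (Sum.fromInj₁ (λ s → contradiction s ¬s) (above-or-initial x 0≤x x≤1)))
          (λ _ → ℚ.≤-reflexive (solve 2 (λ a ε → let δ = con ½ :* ε in
             ((con 1ℚ :+ δ) :- (a :- δ)) :+ con 0ℚ := (con 1ℚ :- a) :+ ε) refl a ε))
    }

  -- `E` is tied to the square by two implications only, so that it can be instantiated with the
  -- very region occurring in `CutNorm≤`.
  square-measure : ∀ {E : Pred (ℝ × ℝ) 0ℓ} →
    (∀ {x y} → E (x , y) → Initial x × Initial y) →
    (∀ {x y} → Initial x × Initial y → E (x , y)) →
    L².HasMeasure E (ι (a ℚ.* a))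
  square-measure {E} to from = record
    { inCube     = λ {(x , y)} s → let (0≤x , x<a) , (0≤y , y<a) = to s in
        (0≤x , <-≤-ι-trans x x<a a≤1) , (0≤y , <-≤-ι-trans y y<a a≤1)
    ; respects   = λ {(x , y)} {(x′ , y′)} (x≈ , y≈) s →
        let (0≤x , x<a) , (0≤y , y<a) = to s in
        from ((≤-respʳ-≈ 0ℝ x x′ x≈ 0≤x , <-respˡ-≈ x x′ (ι a) x≈ x<a) ,
              (≤-respʳ-≈ 0ℝ y y′ y≈ 0≤y , <-respˡ-≈ y y′ (ι a) y≈ y<a))
    ; outer      = outerBound
    ; complement = complementBound
    }
    where
    null² : Interval × Interval
    null² = nullInterval , nullInterval
    outerBound : L².OuterMeasure≤ E (ι (a ℚ.* a))
    outerBound ε 0<ε with slack 0<ε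
    ... | δ , 0<δ , δ≤1 , 16δ≤ε =
      covered-by-two [0,1]² (ι (a ℚ.* a)) ε null² (below , below) null² refl
        (0≤-* (vol≥0 below) (vol≥0 below)) ℚ.≤-refl
        (λ {(x , y)} s → let sx , sy = to s in inj₁ (∈below x sx , ∈below y sy))
        (λ _ → ≤-from-gap _
          (0≤-+ (0≤-* (0≤-+ 0≤δ 0≤δ) 0≤1-a) (0≤-+ (0≤-* 0≤δ (≤⇒0≤gap δ≤1))
            (0≤-+ (≤⇒0≤gap 16δ≤ε) (0≤-* (ℚ.nonNegative⁻¹ (+ 13 ℚ./ 1)) 0≤δ))))
          (solve 3 (λ a δ ε → a :* a :+ ε :=
             ((a :- (:- δ)) :* (a :- (:- δ)) :+ con 0ℚ) :+
             ((δ :+ δ) :* (con 1ℚ :- a) :+ (δ :* (con 1ℚ :- δ) :+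
              ((ε :- con (+ 16 ℚ./ 1) :* δ) :+ con (+ 13 ℚ./ 1) :* δ))))
            refl a δ ε))
      where open Cover 0<δ
    complementBound : L².OuterMeasure≤ (λ z → BoxSpace.Cube [0,1]² z × ¬ E z) (1ℝ - ι (a ℚ.* a))
    complementBound ε 0<ε with slack 0<ε
    ... | δ , 0<δ , δ≤1 , 16δ≤ε =
      -- The complement of the square is [a,1] × [0,1] together with [0,a) × [a,1], of total area (1
      -- - a) + a(1 - a) = 1 - a².
      covered-by-two [0,1]² (1ℝ - ι (a ℚ.* a)) ε null² (above , whole) (below , above) refl
        (0≤-* (vol≥0 above) (vol≥0 whole)) (0≤-* (vol≥0 below) (vol≥0 above))
        cover
        (λ _ → ≤-from-gap _
          (0≤-+ (0≤-* 0≤δ 0≤a) (0≤-+ (0≤-* (ℚ.nonNegative⁻¹ (+ 6 ℚ./ 1)) (0≤-* 0≤δ (≤⇒0≤gap δ≤1)))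
            (0≤-+ (≤⇒0≤gap 16δ≤ε) (0≤-* (ℚ.nonNegative⁻¹ (+ 5 ℚ./ 1)) 0≤δ))))
          (solve 3 (λ a δ ε → (con 1ℚ :- a :* a) :+ ε :=
             (((con 1ℚ :+ δ) :- (a :- δ)) :* ((con 1ℚ :+ δ) :- (:- δ)) :+
              (a :- (:- δ)) :* ((con 1ℚ :+ δ) :- (a :- δ))) :+
             (δ :* a :+ (con (+ 6 ℚ./ 1) :* (δ :* (con 1ℚ :- δ)) :+
              ((ε :- con (+ 16 ℚ./ 1) :* δ) :+ con (+ 5 ℚ./ 1) :* δ))))
            refl a δ ε))
      where
      open Cover 0<δ
      cover : ∀ {z} → BoxSpace.Cube [0,1]² z × ¬ E z →
        BoxSpace._∈ᵇ_ [0,1]² z (above , whole) ⊎ BoxSpace._∈ᵇ_ [0,1]² z (below , above)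
      cover {x , y} (((0≤x , x≤1) , (0≤y , y≤1)) , ¬s) = Sum.[
        (λ x∈ → inj₁ (x∈ , ∈whole y 0≤y y≤1)) ,
        (λ sx → inj₂ (∈below x sx , Sum.fromInj₁ (λ sy → contradiction (from (sx , sy)) ¬s)
          (above-or-initial y 0≤y y≤1))) ] (above-or-initial x 0≤x x≤1)

-- Graphs with an empty block are far from quasirandom

≤-+ι : ∀ x ε → 0ℚ ℚ.< ε → x ≤ x + ι ε
≤-+ι x ε 0<ε η 0<η = 0 , λ n _ →
  ≤-from-gap (ε ℚ.+ η) (0≤-+ (ℚ.<⇒≤ 0<ε) (ℚ.<⇒≤ 0<η)) (ℚ.+-assoc (approx x n) ε η)

-‿monoˡ-≤ : ∀ x y z → x ≤ y → x - z ≤ y - z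
-‿monoˡ-≤ x y z x≤y ε 0<ε with x≤y ε 0<ε
... | N , h = N , λ n N≤n → ≤-from-gap _ (≤⇒0≤gap (h n N≤n))
  (solve 4 (λ x y z ε → (y :- z) :+ ε := (x :- z) :+ ((y :+ ε) :- x))
    refl (approx x n) (approx y n) (approx z n) ε)

-- The vertices i with i/n < a are those whose part meets [0,a), including a part that straddles
-- `a`.
SpansNoEdges : DirectedGraph → ℚ → Set
SpansNoEdges G a = ∀ i j → + toℕ i ℚ./ order ℚ.< a → + toℕ j ℚ./ order ℚ.< a → ¬ i ⟶ j
  where open DirectedGraph G

module _ {a : ℚ} (0<a : 0ℚ ℚ.< a) (a≤1 : a ℚ.≤ 1ℚ) where
  open InitialBlock 0<a a≤1

  W-vanishes : ∀ (G : DirectedGraph) → SpansNoEdges G a →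
    ∀ x y w → Initial x → Initial y → W G (x , y) w → w ≈ 0ℝ
  W-vanishes G empty x y w (_ , x<a) (_ , y<a) (i , j , (i≤x , _) , (j≤y , _) , w≈) =
    subst (λ b → w ≈ (if b then 1ℝ else 0ℝ))
      (dec-false (i ⟶? j) (empty i j (ι-≤-<⇒< x i≤x x<a) (ι-≤-<⇒< y j≤y y<a))) w≈
    where open DirectedGraph G

  -- The integrand is constantly -q on the block, so a single piece has equal lower and upper sums.
  -- The value is written as a one-term `∑` because both sums then compute to it.
  integral-over-block : ∀ (G : DirectedGraph) → SpansNoEdges G a → ∀ q {E : Pred (ℝ × ℝ) 0ℓ} →
    (∀ {x y} → E (x , y) → Initial x × Initial y) →
    (∀ {x y} → Initial x × Initial y → E (x , y)) →
    L².HasIntegral (W G −const q) E (∑ {1} (λ _ → (0ℝ - q) * ι (a ℚ.* a)))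
  integral-over-block G empty q {E} to from ε 0<ε = bounds , ≤-+ι total ε 0<ε , ≤-+ι total ε 0<ε
    where
    total : ℝ
    total = ∑ {1} (λ _ → (0ℝ - q) * ι (a ℚ.* a))
    bounds : L².SimpleBounds (W G −const q) E
    bounds = record
      { pieces   = 1
      ; A        = λ _ → E
      ; measure  = λ _ → ι (a ℚ.* a)
      ; lo       = λ _ → 0ℝ - q
      ; hi       = λ _ → 0ℝ - q
      ; measured = λ _ → square-measure to from
      ; disjoint = λ { {zero} {zero} 0≢0 _ → contradiction refl 0≢0 }
      ; within   = λ _ → id
      ; covers   = λ s ¬s → ¬s (zero , s)
      ; bounds   = λ { {x = x , y} {r} s (w , Ww , r≈) →
          let sx , sy = to s
              0≤w , w≤0 = swap (W-vanishes G empty x y w sx sy Ww) in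
          ≤-respʳ-≈ (0ℝ - q) (w - q) r (swap r≈) (-‿monoˡ-≤ 0ℝ w q 0≤w) ,
          ≤-respˡ-≈ (w - q) r (0ℝ - q) (swap r≈) (-‿monoˡ-≤ w 0ℝ q w≤0) }
      }

-- Limits of rational sequences and the obstruction to forcing

infixr 8 _^ℚ_
_^ℚ_ : ℚ → ℕ → ℚ
x ^ℚ zero  = 1ℚ
x ^ℚ suc k = x ℚ.* x ^ℚ k

approx-^ : ∀ x q n → approx x n ≡ q → ∀ k → approx (x ^ k) n ≡ q ^ℚ k
approx-^ x q n eq zero    = refl
approx-^ x q n eq (suc k) = cong₂ ℚ._*_ eq (approx-^ x q n eq k)

infix 4 _⟶ℚ_
_⟶ℚ_ : (ℕ → ℚ) → ℚ → Set
s ⟶ℚ l = ∀ ε → 0ℚ ℚ.< ε → ∃[ N ] ∀ n → N ℕ.≤ n → ℚ.∣ s n ℚ.- l ∣ ℚ.≤ ε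

⟶ℚ-const : ∀ s l → (∀ n → s n ≡ l) → s ⟶ℚ l
⟶ℚ-const s l s≡l ε 0<ε = 0 , λ n _ →
  subst (ℚ._≤ ε) (sym (cong ℚ.∣_∣ (trans (cong (ℚ._- l) (s≡l n)) (ℚ.+-inverseʳ l)))) (ℚ.<⇒≤ 0<ε)

-- The limits in `DirectedForcing` are products and powers of reals rather than values of `ι`. For
-- rational p all their approximants are one and the same rational, which is what is asked of `x`.
ι-converges : ∀ s l → s ⟶ℚ l → ∀ x → (∀ n → approx x n ≡ l) → (λ n → ι (s n)) ConvergesTo x
ι-converges s l s→l x x≡l ε 0<ε with s→l ε 0<ε
... | N , h = N , λ n N≤n η 0<η → 0 , λ m _ →
  ℚ.≤-trans (subst (λ r → ℚ.∣ s n ℚ.- r ∣ ℚ.≤ ε) (sym (x≡l m)) (h n N≤n))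
    (≤-from-gap η (ℚ.<⇒≤ 0<η) refl)

⟶ℚ-cong : ∀ {f g l} → (∀ n → f n ≡ g n) → f ⟶ℚ l → g ⟶ℚ l
⟶ℚ-cong {l = l} f≡g f→l ε 0<ε =
  let N , h = f→l ε 0<ε in N , λ n N≤n → subst (λ x → ℚ.∣ x ℚ.- l ∣ ℚ.≤ ε) (f≡g n) (h n N≤n)

-- Opaque, because comparing densities by unfolding them to reduced
-- fractions is prohibitively slow.
opaque
  homDensity : OrientedGraph → OrientedGraph → ℚ
  homDensity = t

  homDensity≡t : ∀ B G → homDensity B G ≡ t B G
  homDensity≡t B G = refl

block-obstructs-forcing : ∀ B {p a} → 0ℚ ℚ.< p → p ℚ.≤ 1ℚ → 0ℚ ℚ.< a → a ℚ.≤ 1ℚ →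
  ∀ (G : ℕ → OrientedGraph) → (∀ n → homDensity K⃗₂ (G n) ≡ p ℚ.* ½) →
  (λ n → homDensity B (G n)) ⟶ℚ (p ℚ.* ½) ^ℚ e B →
  (∀ n → SpansNoEdges (OrientedGraph.digraph (G n)) a) → ¬ DirectedForcing B
block-obstructs-forcing B {p} {a} 0<p p≤1 0<a a≤1 G edges B-density empty forcing =
  ℚ.<-irrefl refl c<c
  where
  open InitialBlock 0<a a≤1
  q : ℝ
  q = ι p * ½ℝ
  c : ℚ
  c = p ℚ.* ½ ℚ.* (a ℚ.* a)
  0<c : 0ℚ ℚ.< c
  0<c = 0<-* (0<-* 0<p (ℚ.positive⁻¹ ½)) (0<-* 0<a 0<a)
  quasirandom : Quasirandom q (λ n → OrientedGraph.digraph (G n))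
  quasirandom = forcing (ι p) (ι-mono-≤ (ℚ.<⇒≤ 0<p)) (ι-mono-≤ p≤1) G
    (ι-converges (λ n → t K⃗₂ (G n)) (p ℚ.* ½)
      (⟶ℚ-const (λ n → t K⃗₂ (G n)) (p ℚ.* ½)
        (λ n → trans (sym (homDensity≡t K⃗₂ (G n))) (edges n))) q (λ _ → refl))
    (ι-converges (λ n → t B (G n)) ((p ℚ.* ½) ^ℚ e B)
      (⟶ℚ-cong (λ n → homDensity≡t B (G n)) B-density) (q ^ e B)
      (λ n → approx-^ q (p ℚ.* ½) n refl (e B)))
  w : ℚ
  -- The common approximant of the integral, equal to -c; the final zero is the end of the one-term
  -- sum.
  w = (0ℚ ℚ.- p ℚ.* ½) ℚ.* (a ℚ.* a) ℚ.+ 0ℚ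
  integral-small : ∃[ N ] (∀ n → N ℕ.≤ n → ℚ.∣ w ∣ ℚ.≤ ½ ℚ.* c ℚ.+ ¼ ℚ.* c)
  integral-small =
    let N , small = quasirandom (½ ℚ.* c) (0<½* 0<c) in
    small N ℕ.≤-refl Initial Initial (ι a , initial-measure) (ι a , initial-measure)
      (∑ {1} (λ _ → (0ℝ - q) * ι (a ℚ.* a)))
      (integral-over-block 0<a a≤1 (OrientedGraph.digraph (G N)) (empty N) q id id)
      -- An inequality of reals bounds approximants only up to a margin; the margin c/4 still leaves
      -- 3c/4 < c.
      (¼ ℚ.* c) (0<-* (ℚ.positive⁻¹ ¼) 0<c)
  ¾c-bound : ℚ.- w ℚ.≤ ½ ℚ.* c ℚ.+ ¼ ℚ.* c
  ¾c-bound = ℚ.≤-trans ≤∣ ℚ.- w ∣ (subst (ℚ._≤ ½ ℚ.* c ℚ.+ ¼ ℚ.* c) (sym (ℚ.∣-p∣≡∣p∣ w))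
    (proj₂ integral-small (proj₁ integral-small) ℕ.≤-refl))
  c<c : c ℚ.< c
  c<c = <-from-gap _ (ℚ.+-mono-≤-< (≤⇒0≤gap ¾c-bound) (0<-* (ℚ.positive⁻¹ ¼) 0<c))
    (solve 2 (λ p a →
       let c = p :* con ½ :* (a :* a) ; w = (con 0ℚ :- p :* con ½) :* (a :* a) :+ con 0ℚ in
       c := c :+ (((con ½ :* c :+ con ¼ :* c) :- (:- w)) :+ con ¼ :* c)) refl p a)

-- Counting functions between finite sets

⟦_⟧ : ∀ {P : Set} → Dec P → ℕ
⟦ P? ⟧ = if does P? then 1 else 0

⟦⟧-yes : ∀ {P : Set} (P? : Dec P) → P → ⟦ P? ⟧ ≡ 1
⟦⟧-yes (yes _) _ = refl
⟦⟧-yes (no ¬p) p = contradiction p ¬p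

⟦⟧-no : ∀ {P : Set} (P? : Dec P) → ¬ P → ⟦ P? ⟧ ≡ 0
⟦⟧-no (yes p) ¬p = contradiction p ¬p
⟦⟧-no (no _)  _  = refl

⟦⟧-cong : ∀ {P Q : Set} (P? : Dec P) (Q? : Dec Q) → (P → Q) → (Q → P) → ⟦ P? ⟧ ≡ ⟦ Q? ⟧
⟦⟧-cong P? Q? to from = cong (λ b → if b then 1 else 0) (does-⇔ (mk⇔ to from) P? Q?)

⟦⟧-× : ∀ {P Q : Set} (P? : Dec P) (Q? : Dec Q) → ⟦ P? ×-dec Q? ⟧ ≡ ⟦ P? ⟧ ℕ.* ⟦ Q? ⟧
⟦⟧-× (yes _) (yes _) = refl
⟦⟧-× (yes _) (no _)  = refl
⟦⟧-× (no _)  _       = refl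

⟦⟧≤1 : ∀ {P : Set} (P? : Dec P) → ⟦ P? ⟧ ℕ.≤ 1
⟦⟧≤1 (yes _) = ℕ.≤-refl
⟦⟧≤1 (no _)  = ℕ.z≤n

sum-const : ∀ n c → sum {n} (λ _ → c) ≡ n ℕ.* c
sum-const zero    c = refl
sum-const (suc n) c = cong (c ℕ.+_) (sum-const n c)

sum-mono : ∀ {n} {f g : Fin n → ℕ} → (∀ i → f i ℕ.≤ g i) → sum f ℕ.≤ sum g
sum-mono {zero}  f≤g = ℕ.z≤n
sum-mono {suc n} f≤g = ℕ.+-mono-≤ (f≤g zero) (sum-mono (f≤g ∘ suc))

term≤sum : ∀ {n} (f : Fin n → ℕ) i → f i ℕ.≤ sum f
term≤sum f zero    = ℕ.m≤m+n (f zero) _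
term≤sum f (suc i) = ℕ.m≤n⇒m≤o+n (f zero) (term≤sum (f ∘ suc) i)

sum-mono-< : ∀ {n} {f g : Fin n → ℕ} → (∀ i → f i ℕ.≤ g i) → ∀ i → f i ℕ.< g i → sum f ℕ.< sum g
sum-mono-< f≤g zero    fi<gi = ℕ.+-mono-<-≤ fi<gi (sum-mono (f≤g ∘ suc))
sum-mono-< f≤g (suc i) fi<gi = ℕ.+-mono-≤-< (f≤g zero) (sum-mono-< (f≤g ∘ suc) i fi<gi)

sum-++ : ∀ m {n} (f : Fin (m ℕ.+ n) → ℕ) → sum f ≡ sum (λ i → f (i ↑ˡ n)) ℕ.+ sum (λ j → f (m ↑ʳ j))
sum-++ zero    f = refl
sum-++ (suc m) f = trans (cong (f zero ℕ.+_) (sum-++ m (f ∘ suc))) (sym (ℕ.+-assoc (f zero) _ _))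

sum-combine : ∀ m n (f : Fin (m ℕ.* n) → ℕ) → sum f ≡ sum (λ i → sum (λ j → f (combine {m} i j)))
sum-combine zero    n f = refl
sum-combine (suc m) n f = trans (sum-++ n f)
  (cong (sum (λ i → f (i ↑ˡ m ℕ.* n)) ℕ.+_) (sum-combine m n (λ k → f (n ↑ʳ k))))

length-filter-tabulate : ∀ {A : Set} {P : Pred A 0ℓ} (P? : Decidable P) {n} (f : Fin n → A) →
  length (filter P? (tabulate f)) ≡ sum (λ i → ⟦ P? (f i) ⟧)
length-filter-tabulate P? {zero}  f = refl
length-filter-tabulate P? {suc n} f with does (P? (f zero))
... | true  = cong suc (length-filter-tabulate P? (f ∘ suc))
... | false = length-filter-tabulate P? (f ∘ suc)

length-filter-cartesianProduct : ∀ {A B : Set} {P : Pred (A × B) 0ℓ} (P? : Decidable P)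
  {m n} (f : Fin m → A) (g : Fin n → B) →
  length (filter P? (cartesianProduct (tabulate f) (tabulate g))) ≡
  sum (λ i → sum (λ j → ⟦ P? (f i , g j) ⟧))
length-filter-cartesianProduct P? {zero}  f g = refl
length-filter-cartesianProduct P? {suc m} f g = begin
  length (filter P? (map (f zero ,_) (tabulate g) ++ rest))
    ≡⟨ cong length (List.filter-++ P? (map (f zero ,_) (tabulate g)) rest) ⟩
  length (filter P? (map (f zero ,_) (tabulate g)) ++ filter P? rest)
    ≡⟨ List.length-++ (filter P? (map (f zero ,_) (tabulate g))) ⟩
  length (filter P? (map (f zero ,_) (tabulate g))) ℕ.+ length (filter P? rest)
    ≡⟨ cong₂ ℕ._+_
         (trans (cong (length ∘ filter P?) (List.map-tabulate g (f zero ,_)))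
           (length-filter-tabulate P? (λ j → f zero , g j)))
         (length-filter-cartesianProduct P? (f ∘ suc) g) ⟩
  sum (λ j → ⟦ P? (f zero , g j) ⟧) ℕ.+ sum (λ i → sum (λ j → ⟦ P? (f (suc i) , g j) ⟧)) ∎
  where
  open ≡-Reasoning
  rest = cartesianProduct (tabulate (f ∘ suc)) (tabulate g)

e≡∑∑ : ∀ B → e B ≡ sum (λ x → sum (λ y → ⟦ OrientedGraph._⟶?_ B x y ⟧))
e≡∑∑ B = length-filter-cartesianProduct (uncurry (OrientedGraph._⟶?_ B)) (λ i → i) (λ i → i)

-- The sum over all maps, taken one coordinate at a time. Unlike the enumeration in `hom`, this form
-- admits induction on the domain.
∑ᶠ : ∀ k {n} → ((Fin k → Fin n) → ℕ) → ℕ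
∑ᶠ zero    F = F Vec.[]
∑ᶠ (suc k) F = sum (λ i → ∑ᶠ k (λ f → F (i Vec.∷ f)))

-- Pointwise equal maps need not be identical, so changing variables in `∑ᶠ` requires this of the
-- summand.
Extensional : ∀ {k n} → ((Fin k → Fin n) → ℕ) → Set
Extensional F = ∀ {f g} → f ≗ g → F f ≡ F g

∷-cong : ∀ {k n} {i j : Fin n} {f g : Fin k → Fin n} → i ≡ j → f ≗ g → (i Vec.∷ f) ≗ (j Vec.∷ g)
∷-cong i≡j f≗g zero    = i≡j
∷-cong i≡j f≗g (suc u) = f≗g u

module _ {n : ℕ} where

  ∑ᶠ-cong : ∀ k {F G : (Fin k → Fin n) → ℕ} → F ≗ G → ∑ᶠ k F ≡ ∑ᶠ k G
  ∑ᶠ-cong zero    F≗G = F≗G Vec.[]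
  ∑ᶠ-cong (suc k) F≗G = sum-cong-≗ {n} (λ i → ∑ᶠ-cong k (λ f → F≗G (i Vec.∷ f)))

  ∑ᶠ-mono : ∀ k {F G : (Fin k → Fin n) → ℕ} → (∀ f → F f ℕ.≤ G f) → ∑ᶠ k F ℕ.≤ ∑ᶠ k G
  ∑ᶠ-mono zero    F≤G = F≤G Vec.[]
  ∑ᶠ-mono (suc k) F≤G = sum-mono (λ i → ∑ᶠ-mono k (λ f → F≤G (i Vec.∷ f)))

  ∑ᶠ-const : ∀ k c → ∑ᶠ k {n} (λ _ → c) ≡ n ℕ.^ k ℕ.* c
  ∑ᶠ-const zero    c = sym (ℕ.+-identityʳ c)
  ∑ᶠ-const (suc k) c = trans (trans (sum-cong-≗ {n} (λ _ → ∑ᶠ-const k c)) (sum-const n _))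
    (sym (ℕ.*-assoc n _ c))

  ∑ᶠ-+ : ∀ k (F G : (Fin k → Fin n) → ℕ) → ∑ᶠ k (λ f → F f ℕ.+ G f) ≡ ∑ᶠ k F ℕ.+ ∑ᶠ k G
  ∑ᶠ-+ zero    F G = refl
  ∑ᶠ-+ (suc k) F G = trans (sum-cong-≗ {n} (λ i → ∑ᶠ-+ k _ _))
    (∑-distrib-+ {n} (λ i → ∑ᶠ k (λ f → F (i Vec.∷ f))) (λ i → ∑ᶠ k (λ f → G (i Vec.∷ f))))

  ∑ᶠ-*ˡ : ∀ k c (F : (Fin k → Fin n) → ℕ) → ∑ᶠ k (λ f → c ℕ.* F f) ≡ c ℕ.* ∑ᶠ k F
  ∑ᶠ-*ˡ zero    c F = refl
  ∑ᶠ-*ˡ (suc k) c F = trans (sum-cong-≗ {n} (λ i → ∑ᶠ-*ˡ k c _))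
    (sym (*-distribˡ-sum {n} c (λ i → ∑ᶠ k (λ f → F (i Vec.∷ f)))))

  ∑ᶠ-sum : ∀ k {m} (F : Fin m → (Fin k → Fin n) → ℕ) →
    ∑ᶠ k (λ f → sum (λ u → F u f)) ≡ sum (λ u → ∑ᶠ k (F u))
  ∑ᶠ-sum zero    F = refl
  ∑ᶠ-sum (suc k) {m} F = trans (sum-cong-≗ {n} (λ i → ∑ᶠ-sum k {m} (λ u f → F u (i Vec.∷ f))))
    (∑-comm {n} {m} (λ i u → ∑ᶠ k (λ f → F u (i Vec.∷ f))))

  -- Change of variables with a separate permutation for each coordinate. That `σ u` permutes is
  -- expressed by invariance of sums, the form in which the induction consumes it.
  ∑ᶠ-permute : ∀ k (σ : Fin k → Fin n → Fin n) → (∀ u g → sum (λ i → g (σ u i)) ≡ sum g) →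
    ∀ {F : (Fin k → Fin n) → ℕ} → Extensional F → ∑ᶠ k (λ f → F (λ u → σ u (f u))) ≡ ∑ᶠ k F
  ∑ᶠ-permute zero    σ inv {F} ext = ext (λ ())
  ∑ᶠ-permute (suc k) σ inv {F} ext = begin
    sum (λ i → ∑ᶠ k (λ f → F (λ u → σ u ((i Vec.∷ f) u))))
      ≡⟨ sum-cong-≗ {n} (λ i → ∑ᶠ-cong k (λ f →
           ext {g = σ zero i Vec.∷ (λ u → σ (suc u) (f u))} λ { zero → refl ; (suc u) → refl })) ⟩
    sum (λ i → ∑ᶠ k (λ f → F (σ zero i Vec.∷ (λ u → σ (suc u) (f u)))))
      ≡⟨ sum-cong-≗ {n} (λ i → ∑ᶠ-permute k (σ ∘ suc) (inv ∘ suc)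
           (λ f≗g → ext (∷-cong {i = σ zero i} refl f≗g))) ⟩
    sum (λ i → ∑ᶠ k (λ f → F (σ zero i Vec.∷ f)))
      ≡⟨ inv zero (λ i → ∑ᶠ k (λ f → F (i Vec.∷ f))) ⟩
    sum (λ i → ∑ᶠ k (λ f → F (i Vec.∷ f))) ∎
    where open ≡-Reasoning

  ∑ᶠ-product : ∀ k (g : Fin k → Fin n → ℕ) →
    ∑ᶠ k (λ f → product (λ u → g u (f u))) ≡ product (λ u → sum (g u))
  ∑ᶠ-product zero    g = refl
  ∑ᶠ-product (suc k) g = begin
    sum (λ i → ∑ᶠ k (λ f → g zero i ℕ.* product (λ u → g (suc u) (f u))))
      ≡⟨ sum-cong-≗ {n} (λ i → trans (∑ᶠ-*ˡ k (g zero i) _)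
           (cong (g zero i ℕ.*_) (∑ᶠ-product k (g ∘ suc)))) ⟩
    sum (λ i → g zero i ℕ.* product (λ u → sum (g (suc u))))
      ≡⟨ sym (*-distribʳ-sum {n} _ (g zero)) ⟩
    sum (g zero) ℕ.* product (λ u → sum (g (suc u))) ∎
    where open ≡-Reasoning

  -- The other k - 1 coordinates are free; the factor `n` on the left avoids the exponent k - 1.
  ∑ᶠ-coordinate : ∀ k (h : Fin n → ℕ) u → n ℕ.* ∑ᶠ k (λ f → h (f u)) ≡ n ℕ.^ k ℕ.* sum h
  ∑ᶠ-coordinate (suc k) h zero    = begin
    n ℕ.* sum (λ i → ∑ᶠ k {n} (λ _ → h i))
      ≡⟨ cong (n ℕ.*_) (sum-cong-≗ {n} (λ i → ∑ᶠ-const k (h i))) ⟩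
    n ℕ.* sum (λ i → n ℕ.^ k ℕ.* h i)
      ≡⟨ cong (n ℕ.*_) (sym (*-distribˡ-sum {n} (n ℕ.^ k) h)) ⟩
    n ℕ.* (n ℕ.^ k ℕ.* sum h)
      ≡⟨ sym (ℕ.*-assoc n _ _) ⟩
    n ℕ.^ suc k ℕ.* sum h ∎
    where open ≡-Reasoning
  ∑ᶠ-coordinate (suc k) h (suc u) = begin
    n ℕ.* sum {n} (λ _ → ∑ᶠ k (λ f → h (f u)))
      ≡⟨ cong (n ℕ.*_) (sum-const n _) ⟩
    n ℕ.* (n ℕ.* ∑ᶠ k (λ f → h (f u)))
      ≡⟨ cong (n ℕ.*_) (∑ᶠ-coordinate k h u) ⟩
    n ℕ.* (n ℕ.^ k ℕ.* sum h)
      ≡⟨ sym (ℕ.*-assoc n _ _) ⟩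
    n ℕ.^ suc k ℕ.* sum h ∎
    where open ≡-Reasoning

  sum-finToFun : ∀ k {F : (Fin k → Fin n) → ℕ} → Extensional F → sum (λ i → F (finToFun i)) ≡ ∑ᶠ k F
  sum-finToFun zero    {F} ext = trans (ℕ.+-identityʳ _) (ext (λ ()))
  sum-finToFun (suc k) {F} ext = trans (sum-combine n (n ℕ.^ k) (λ i → F (finToFun i)))
    (sum-cong-≗ {n} λ i →
    trans (sum-cong-≗ {n ℕ.^ k} λ j → ext {g = i Vec.∷ finToFun j} λ
            { zero    → cong proj₁ (Fin.remQuot-combine {n} i j)
            ; (suc u) → cong (λ p → finToFun {n} {k} (proj₂ p) u) (Fin.remQuot-combine {n} i j) })
          (sum-finToFun k (λ f≗g → ext (∷-cong {i = i} refl f≗g))))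

product-1 : ∀ {n} {g : Fin n → ℕ} → (∀ u → g u ≡ 1) → product g ≡ 1
product-1 {zero}  all1 = refl
product-1 {suc n} all1 = cong₂ ℕ._*_ (all1 zero) (product-1 (all1 ∘ suc))

product-0 : ∀ {n} {g : Fin n → ℕ} u → g u ≡ 0 → product g ≡ 0
product-0 {suc n} {g} zero    gu≡0 = cong (ℕ._* product (g ∘ suc)) gu≡0
product-0 {suc n} {g} (suc u) gu≡0 =
  trans (cong (g zero ℕ.*_) (product-0 u gu≡0)) (ℕ.*-zeroʳ (g zero))

module _ (B G : OrientedGraph) where
  private
    module G = OrientedGraph G

  homIndicator-ext : Extensional (λ f → ⟦ isHomomorphism? B G f ⟧)
  homIndicator-ext {f} {g} f≗g = ⟦⟧-cong (isHomomorphism? B G f) (isHomomorphism? B G g)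
    (λ h x y x⟶y → subst₂ G._⟶_ (f≗g x) (f≗g y) (h x y x⟶y))
    (λ h x y x⟶y → subst₂ G._⟶_ (sym (f≗g x)) (sym (f≗g y)) (h x y x⟶y))

  hom≡∑ᶠ : hom B G ≡ ∑ᶠ (v B) (λ f → ⟦ isHomomorphism? B G f ⟧)
  hom≡∑ᶠ = trans
    (length-filter-tabulate (λ i → isHomomorphism? B G (finToFun {v G} {v B} i)) (λ i → i))
    (sum-finToFun (v B) homIndicator-ext)

hom-K⃗₂ : ∀ G → hom K⃗₂ G ≡ sum (λ i → sum (λ j → ⟦ OrientedGraph._⟶?_ G i j ⟧))
hom-K⃗₂ G = trans (hom≡∑ᶠ K⃗₂ G) (sum-cong-≗ {v G} λ i → sum-cong-≗ {v G} λ j →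
  ⟦⟧-cong (isHomomorphism? K⃗₂ G (i Vec.∷ j Vec.∷ Vec.[])) (i ⟶? j)
    (λ h → h zero (suc zero) (refl , refl))
    (λ { i⟶j _ _ (refl , refl) → i⟶j }))
  where open OrientedGraph G

-- Ratios of natural numbers

/-mono-≤ : ∀ a b c d .{{_ : ℕ.NonZero b}} .{{_ : ℕ.NonZero d}} →
  a ℕ.* d ℕ.≤ c ℕ.* b → + a ℚ./ b ℚ.≤ + c ℚ./ d
/-mono-≤ a (suc b) c (suc d) ad≤cb = ℚ.toℚᵘ-cancel-≤
  (ℚᵘ.≤-respʳ-≃ (ℚᵘ.≃-sym (ℚ.toℚᵘ-fromℚᵘ (ℚᵘ.mkℚᵘ (+ c) d)))
  (ℚᵘ.≤-respˡ-≃ (ℚᵘ.≃-sym (ℚ.toℚᵘ-fromℚᵘ (ℚᵘ.mkℚᵘ (+ a) b)))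
  (ℚᵘ.*≤* (subst₂ ℤ._≤_ (ℤ.pos-* a (suc d)) (ℤ.pos-* c (suc b)) (ℤ.+≤+ ad≤cb)))))

/-≡ : ∀ a b c d .{{_ : ℕ.NonZero b}} .{{_ : ℕ.NonZero d}} →
  a ℕ.* d ≡ c ℕ.* b → + a ℚ./ b ≡ + c ℚ./ d
/-≡ a b c d ad≡cb = ℚ.≤-antisym
  (/-mono-≤ a b c d (ℕ.≤-reflexive ad≡cb)) (/-mono-≤ c d a b (ℕ.≤-reflexive (sym ad≡cb)))

/-positive : ∀ a b .{{_ : ℕ.NonZero a}} .{{_ : ℕ.NonZero b}} → 0ℚ ℚ.< + a ℚ./ b
/-positive a b = ℚ.positive⁻¹ (+ a ℚ./ b) {{ℚ.normalize-pos a b}}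

/-* : ∀ a b c d .{{_ : ℕ.NonZero b}} .{{_ : ℕ.NonZero d}} .{{_ : ℕ.NonZero (b ℕ.* d)}} →
  (+ a ℚ./ b) ℚ.* (+ c ℚ./ d) ≡ + (a ℕ.* c) ℚ./ (b ℕ.* d)
/-* a (suc b) c (suc d) = ℚ.toℚᵘ-injective (ℚᵘ.≃-trans
  (ℚ.toℚᵘ-homo-* (+ a ℚ./ suc b) (+ c ℚ./ suc d)) (ℚᵘ.≃-trans
  (ℚᵘ.*-cong (ℚ.toℚᵘ-fromℚᵘ (ℚᵘ.mkℚᵘ (+ a) b)) (ℚ.toℚᵘ-fromℚᵘ (ℚᵘ.mkℚᵘ (+ c) d))) (ℚᵘ.≃-trans
  (ℚᵘ.≃-reflexive (cong (λ n → ℚᵘ.mkℚᵘ n (d ℕ.+ b ℕ.* suc d)) (sym (ℤ.pos-* a c))))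
  (ℚᵘ.≃-sym (ℚ.toℚᵘ-fromℚᵘ (ℚᵘ.mkℚᵘ (+ (a ℕ.* c)) (d ℕ.+ b ℕ.* suc d)))))))

/-+ : ∀ a b c d .{{_ : ℕ.NonZero b}} .{{_ : ℕ.NonZero d}} .{{_ : ℕ.NonZero (b ℕ.* d)}} →
  (+ a ℚ./ b) ℚ.+ (+ c ℚ./ d) ≡ + (a ℕ.* d ℕ.+ c ℕ.* b) ℚ./ (b ℕ.* d)
/-+ a (suc b) c (suc d) = ℚ.toℚᵘ-injective (ℚᵘ.≃-trans
  (ℚ.toℚᵘ-homo-+ (+ a ℚ./ suc b) (+ c ℚ./ suc d)) (ℚᵘ.≃-trans
  (ℚᵘ.+-cong (ℚ.toℚᵘ-fromℚᵘ (ℚᵘ.mkℚᵘ (+ a) b)) (ℚ.toℚᵘ-fromℚᵘ (ℚᵘ.mkℚᵘ (+ c) d))) (ℚᵘ.≃-trans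
  (ℚᵘ.≃-reflexive (cong (λ n → ℚᵘ.mkℚᵘ n (d ℕ.+ b ℕ.* suc d))
    (sym (trans (ℤ.pos-+ (a ℕ.* suc d) (c ℕ.* suc b))
      (cong₂ ℤ._+_ (ℤ.pos-* a (suc d)) (ℤ.pos-* c (suc b)))))))
  (ℚᵘ.≃-sym (ℚ.toℚᵘ-fromℚᵘ (ℚᵘ.mkℚᵘ (+ (a ℕ.* suc d ℕ.+ c ℕ.* suc b)) (d ℕ.+ b ℕ.* suc d)))))))

/-^ : ∀ a b k .{{_ : ℕ.NonZero b}} .{{_ : ℕ.NonZero (b ℕ.^ k)}} →
  (+ a ℚ./ b) ^ℚ k ≡ + (a ℕ.^ k) ℚ./ (b ℕ.^ k)
/-^ a b zero    = refl
/-^ a b (suc k) = trans (cong ((+ a ℚ./ b) ℚ.*_) (/-^ a b k)) (/-* a b (a ℕ.^ k) (b ℕ.^ k))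
  where
  instance
    bᵏ≢0 : ℕ.NonZero (b ℕ.^ k)
    bᵏ≢0 = ℕ.m^n≢0 b k

module _ (B G : OrientedGraph) where
  private
    N : ℕ
    N = v G ℕ.^ v B
    instance
      N≢0 : ℕ.NonZero N
      N≢0 = ℕ.m^n≢0 (v G) (v B) {{OrientedGraph.order≢0 G}}

  homDensity≡ratio : ∀ a b .{{_ : ℕ.NonZero b}} → hom B G ℕ.* b ≡ a ℕ.* v G ℕ.^ v B →
    homDensity B G ≡ + a ℚ./ b
  homDensity≡ratio a b eq = trans (homDensity≡t B G) (/-≡ (hom B G) N a b eq)

  homDensity≤ratio : ∀ a b .{{_ : ℕ.NonZero b}} → hom B G ℕ.* b ℕ.≤ a ℕ.* v G ℕ.^ v B →
    homDensity B G ℚ.≤ + a ℚ./ b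
  homDensity≤ratio a b h = subst (ℚ._≤ + a ℚ./ b) (sym (homDensity≡t B G))
    (/-mono-≤ (hom B G) N a b h)

  ratio≤homDensity : ∀ a b .{{_ : ℕ.NonZero b}} → a ℕ.* v G ℕ.^ v B ℕ.≤ hom B G ℕ.* b →
    + a ℚ./ b ℚ.≤ homDensity B G
  ratio≤homDensity a b h = subst (+ a ℚ./ b ℚ.≤_) (sym (homDensity≡t B G))
    (/-mono-≤ a b (hom B G) N h)

  homDensity-increment : ∀ G′ → v G′ ≡ v G → ∀ a k .{{_ : ℕ.NonZero k}} →
    hom B G′ ℕ.* k ℕ.≤ hom B G ℕ.* k ℕ.+ a ℕ.* v G ℕ.^ v B →
    homDensity B G′ ℚ.≤ homDensity B G ℚ.+ + a ℚ./ k
  homDensity-increment G′ same a k h =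
    subst₂ (λ x y → x ℚ.≤ y ℚ.+ + a ℚ./ k) (sym (homDensity≡t B G′)) (sym (homDensity≡t B G))
    (subst (t B G′ ℚ.≤_) (sym (/-+ (hom B G) N a k))
    (/-mono-≤ (hom B G′) (v G′ ℕ.^ v B) (hom B G ℕ.* k ℕ.+ a ℕ.* N) (N ℕ.* k)
      {{ℕ.m^n≢0 (v G′) (v B) {{OrientedGraph.order≢0 G′}}}} (begin
      hom B G′ ℕ.* (N ℕ.* k)
        ≡⟨ solveℕ 3 (λ h N k → h ⊛ (N ⊛ k) ⊜ h ⊛ k ⊛ N) refl (hom B G′) N k ⟩
      hom B G′ ℕ.* k ℕ.* N
        ≤⟨ ℕ.*-monoˡ-≤ N h ⟩
      (hom B G ℕ.* k ℕ.+ a ℕ.* N) ℕ.* N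
        ≡⟨ cong (λ r → (hom B G ℕ.* k ℕ.+ a ℕ.* N) ℕ.* r ℕ.^ v B) (sym same) ⟩
      (hom B G ℕ.* k ℕ.+ a ℕ.* N) ℕ.* v G′ ℕ.^ v B ∎)))
    where
    open ℕ.≤-Reasoning
    instance
      Nk≢0 : ℕ.NonZero (N ℕ.* k)
      Nk≢0 = ℕ.m*n≢0 N k

-- Acyclic graphs

record SimplePath {n : ℕ} (S : Rel (Fin n) 0ℓ) (x y : Fin n) : Set where
  field
    len       : ℕ
    at        : Fin (suc len) → Fin n
    injective : Injective _≡_ _≡_ at
    step      : ∀ (i : Fin len) → S (at (inject₁ i)) (at (suc i))
    start     : at zero ≡ x
    end       : at (fromℕ len) ≡ y

module _ {n : ℕ} {S : Rel (Fin n) 0ℓ} where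
  open SimplePath

  dropTo : ∀ {x y} (P : SimplePath S x y) i → SimplePath S (at P i) y
  dropTo {y = y} P zero = subst (λ u → SimplePath S u y) (sym (start P)) P
  dropTo record { len = suc k ; at = c ; injective = inj ; step = st ; end = e } (suc i) =
    dropTo record
      { len = k ; at = c ∘ suc ; injective = Fin.suc-injective ∘ inj
      ; step = st ∘ suc ; start = refl ; end = e } i

  -- Loop erasure: if `x` already lies on the path, only the part from that occurrence onwards is
  -- kept.
  prepend : ∀ {x w y} → S x w → SimplePath S w y → SimplePath S x y
  prepend {x} {w} {y} xSw P with Fin.any? (λ i → at P i Fin.≟ x)
  ... | yes (i , ati≡x) = subst (λ u → SimplePath S u y) ati≡x (dropTo P i)
  ... | no fresh = record
    { len = suc (len P)
    ; at = x Vec.∷ at P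
    ; injective = inj
    ; step = λ { zero → subst (S x) (sym (start P)) xSw ; (suc i) → step P i }
    ; start = refl
    ; end = end P
    }
    where
    inj : Injective _≡_ _≡_ (x Vec.∷ at P)
    inj {zero}  {zero}  _  = refl
    inj {zero}  {suc j} eq = contradiction (j , sym eq) fresh
    inj {suc i} {zero}  eq = contradiction (i , eq) fresh
    inj {suc i} {suc j} eq = cong suc (injective P eq)

simplePath : ∀ {n} {R : Rel (Fin n) 0ℓ} {x y} → EqClosure R x y → SimplePath (SymClosure R) x y
simplePath {x = x} trivial = record
  { len = 0 ; at = λ _ → x ; injective = λ { {zero} {zero} _ → refl }
  ; step = λ () ; start = refl ; end = refl }
simplePath (r ◅ rs) = prepend r (simplePath rs)

-- Union–find without path compression: label L is constant exactly on the
-- connected components of the graph with edge list L.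
label : ∀ {n} → List (Fin n × Fin n) → Fin n → Fin n
label []            w = w
label ((a , b) ∷ L) w = if does (label L w Fin.≟ label L a) then label L b else label L w

Listed : ∀ {n} → List (Fin n × Fin n) → Rel (Fin n) 0ℓ
Listed L a b = (a , b) ∈ L

label-connected : ∀ {n} (L : List (Fin n × Fin n)) w → EqClosure (Listed L) w (label L w)
label-connected []            w = trivial
label-connected ((a , b) ∷ L) w with label L w Fin.≟ label L a
... | no _  = EqC.map there (label-connected L w)
-- The route runs from `w` to its old label, which is also that of `a`, back to `a`, across the new
-- edge to `b`, and on to the label of `b`.
... | yes p = EqC.map there (label-connected L w) ◅◅
  subst (λ u → EqClosure (Listed ((a , b) ∷ L)) u (label L b)) (sym p)
    (EqC.symmetric _ (EqC.map there (label-connected L a)) ◅◅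
     (fwd (here refl) ◅ EqC.map there (label-connected L b)))

label≡⇒connected : ∀ {n} (L : List (Fin n × Fin n)) {x y} →
  label L x ≡ label L y → EqClosure (Listed L) x y
label≡⇒connected L {x} {y} eq = label-connected L x ◅◅
  subst (λ u → EqClosure (Listed L) u y) (sym eq) (EqC.symmetric _ (label-connected L y))

label-edge : ∀ {n} (L : List (Fin n × Fin n)) {a b} → (a , b) ∈ L → label L a ≡ label L b
label-edge ((a , b) ∷ L) (here refl) with label L a Fin.≟ label L a | label L b Fin.≟ label L a
... | yes _  | yes _ = refl
... | yes _  | no _  = refl
... | no a≢a | _     = contradiction refl a≢a
label-edge ((a , b) ∷ L) (there ab∈L) =
  cong (λ u → if does (u Fin.≟ label L a) then label L b else u) (label-edge L ab∈L)

-- Homomorphisms of forests to the directed triangle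

rot : Fin 3 → Fin 3
rot zero             = suc zero
rot (suc zero)       = suc (suc zero)
rot (suc (suc zero)) = zero

rot³ : ∀ i → rot (rot (rot i)) ≡ i
rot³ zero             = refl
rot³ (suc zero)       = refl
rot³ (suc (suc zero)) = refl

rot-injective : ∀ {i j} → rot i ≡ rot j → i ≡ j
rot-injective {i} {j} eq = trans (sym (rot³ i)) (trans (cong (rot ∘ rot) eq) (rot³ j))

C⃗₃ : OrientedGraph
C⃗₃ = record
  { digraph    = record { order = 3 ; _⟶_ = λ i j → j ≡ rot i ; _⟶?_ = λ i j → j Fin.≟ rot i }
  ; asymmetric = λ { {zero} refl () ; {suc zero} refl () ; {suc (suc zero)} refl () }
  }

module _ {n : ℕ} where

  follows? : (f : Fin n → Fin 3) → (xy : Fin n × Fin n) → Dec (f (proj₂ xy) ≡ rot (f (proj₁ xy)))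
  follows? f (x , y) = f y Fin.≟ rot (f x)

  satisfied : List (Fin n × Fin n) → (Fin n → Fin 3) → ℕ
  satisfied L f = ⟦ All.all? (follows? f) L ⟧

  satisfied-∷ : ∀ x y L f → satisfied ((x , y) ∷ L) f ≡ ⟦ f y Fin.≟ rot (f x) ⟧ ℕ.* satisfied L f
  satisfied-∷ x y L f = ⟦⟧-× (follows? f (x , y)) (All.all? (follows? f) L)

  satisfied-ext : ∀ L → Extensional (satisfied L)
  satisfied-ext L {f} {g} f≗g = ⟦⟧-cong (All.all? (follows? f) L) (All.all? (follows? g) L)
    (All.map λ { {x , y} eq → trans (sym (f≗g y)) (trans eq (cong rot (f≗g x))) })
    (All.map λ { {x , y} eq → trans (f≗g y) (trans eq (cong rot (sym (f≗g x)))) })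

  rotateIf : Bool → Fin 3 → Fin 3
  rotateIf b i = if b then rot i else i

  rotateIf-injective : ∀ b {i j} → rotateIf b i ≡ rotateIf b j → i ≡ j
  rotateIf-injective true  = rot-injective
  rotateIf-injective false = λ eq → eq

  rotateIf-rot : ∀ b i → rotateIf b (rot i) ≡ rot (rotateIf b i)
  rotateIf-rot true  i = refl
  rotateIf-rot false i = refl

  sum-rotateIf : ∀ b (g : Fin 3 → ℕ) → sum (λ i → g (rotateIf b i)) ≡ sum g
  sum-rotateIf true  g = solveℕ 3 (λ a b c → b ⊕ (c ⊕ (a ⊕ lit 0)) ⊜ a ⊕ (b ⊕ (c ⊕ lit 0))) refl
    (g zero) (g (suc zero)) (g (suc (suc zero)))
  sum-rotateIf false g = refl

  module _ (L : List (Fin n × Fin n)) (x y : Fin n) (x≢y : label L x ≢ label L y) where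

    inside : Fin n → Bool
    inside w = does (label L w Fin.≟ label L y)

    rotateInside : (Fin n → Fin 3) → Fin n → Fin 3
    rotateInside f w = rotateIf (inside w) (f w)

    rotateInside-x : ∀ f → rotateInside f x ≡ f x
    rotateInside-x f = cong (λ b → rotateIf b (f x)) (dec-false (label L x Fin.≟ label L y) x≢y)

    rotateInside-y : ∀ f → rotateInside f y ≡ rot (f y)
    rotateInside-y f = cong (λ b → rotateIf b (f y)) (dec-true (label L y Fin.≟ label L y) refl)

    -- An edge of `L` lies within one component, so both of its ends are rotated or neither is, and
    -- `rot` is an automorphism of the triangle.
    rotateInside-satisfied : ∀ f → satisfied L (rotateInside f) ≡ satisfied L f
    rotateInside-satisfied f = ⟦⟧-cong
      (All.all? (follows? (rotateInside f)) L) (All.all? (follows? f) L)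
      (λ all → All.tabulate λ { {a , b} ab∈L → rotateIf-injective (inside a)
        (trans (trans (cong (λ c → rotateIf c (f b)) (same ab∈L)) (All.lookup all ab∈L))
          (sym (rotateIf-rot (inside a) (f a)))) })
      (λ all → All.tabulate λ { {a , b} ab∈L →
        trans (cong₂ rotateIf (sym (same ab∈L)) (All.lookup all ab∈L))
          (rotateIf-rot (inside a) (f a)) })
      where
      same : ∀ {a b} → (a , b) ∈ L → inside a ≡ inside b
      same ab∈L = cong (λ u → does (u Fin.≟ label L y)) (label-edge L ab∈L)

    -- For `ρ` a power of `rot`, this counts the homomorphisms of `L` with a prescribed difference
    -- modulo 3 between the images of `y` and `x`.
    offset : (Fin 3 → Fin 3) → ℕ
    offset ρ = ∑ᶠ n (λ f → ⟦ f y Fin.≟ ρ (f x) ⟧ ℕ.* satisfied L f)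

    -- The substitution `rotateInside` rotates the image of `y` and fixes that of `x`, hence shifts
    -- the offset by one.
    offset-rot : ∀ ρ → offset (rot ∘ ρ) ≡ offset ρ
    offset-rot ρ = begin
      offset (rot ∘ ρ)
        ≡⟨ sym (∑ᶠ-permute n (rotateIf ∘ inside) (sum-rotateIf ∘ inside) ext) ⟩
      ∑ᶠ n (λ f → ⟦ rotateInside f y Fin.≟ rot (ρ (rotateInside f x)) ⟧ ℕ.*
        satisfied L (rotateInside f))
        ≡⟨ ∑ᶠ-cong n (λ f → cong₂ ℕ._*_ (unrotate f) (rotateInside-satisfied f)) ⟩
      offset ρ ∎
      where
      open ≡-Reasoning
      ext : Extensional (λ f → ⟦ f y Fin.≟ rot (ρ (f x)) ⟧ ℕ.* satisfied L f)
      ext f≗g = cong₂ ℕ._*_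
        (cong₂ (λ i j → ⟦ i Fin.≟ rot (ρ j) ⟧) (f≗g y) (f≗g x)) (satisfied-ext L f≗g)
      unrotate : ∀ f → ⟦ rotateInside f y Fin.≟ rot (ρ (rotateInside f x)) ⟧ ≡ ⟦ f y Fin.≟ ρ (f x) ⟧
      unrotate f = trans
        (cong₂ (λ i j → ⟦ i Fin.≟ rot (ρ j) ⟧) (rotateInside-y f) (rotateInside-x f))
        (⟦⟧-cong (rot (f y) Fin.≟ rot (ρ (f x))) (f y Fin.≟ ρ (f x)) rot-injective (cong rot))

    offsets-partition : ∀ i j →
      ⟦ j Fin.≟ i ⟧ ℕ.+ (⟦ j Fin.≟ rot i ⟧ ℕ.+ ⟦ j Fin.≟ rot (rot i) ⟧) ≡ 1
    offsets-partition zero zero = refl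
    offsets-partition zero (suc zero) = refl
    offsets-partition zero (suc (suc zero)) = refl
    offsets-partition (suc zero) zero = refl
    offsets-partition (suc zero) (suc zero) = refl
    offsets-partition (suc zero) (suc (suc zero)) = refl
    offsets-partition (suc (suc zero)) zero = refl
    offsets-partition (suc (suc zero)) (suc zero) = refl
    offsets-partition (suc (suc zero)) (suc (suc zero)) = refl

    -- The three offsets exhaust the homomorphisms of `L` and are equally frequent by `offset-rot`;
    -- the new edge prescribes one of them.
    bridge-thirds : ∑ᶠ n (satisfied ((x , y) ∷ L)) ℕ.* 3 ≡ ∑ᶠ n (satisfied L)
    bridge-thirds = begin
      ∑ᶠ n (satisfied ((x , y) ∷ L)) ℕ.* 3
        ≡⟨ cong (ℕ._* 3) (∑ᶠ-cong n (satisfied-∷ x y L)) ⟩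
      offset rot ℕ.* 3
        ≡⟨ solveℕ 1 (λ a → a ⊛ lit 3 ⊜ a ⊕ (a ⊕ a)) refl (offset rot) ⟩
      offset rot ℕ.+ (offset rot ℕ.+ offset rot)
        ≡⟨ cong₂ ℕ._+_ (offset-rot (λ i → i)) (cong (offset rot ℕ.+_) (sym (offset-rot rot))) ⟩
      offset (λ i → i) ℕ.+ (offset rot ℕ.+ offset (rot ∘ rot))
        ≡⟨ sym (trans (∑ᶠ-+ n _ _) (cong (offset (λ i → i) ℕ.+_) (∑ᶠ-+ n _ _))) ⟩
      ∑ᶠ n (λ f → term (λ i → i) f ℕ.+ (term rot f ℕ.+ term (rot ∘ rot) f))
        ≡⟨ ∑ᶠ-cong n (λ f → trans
             (solveℕ 4 (λ a b c s → a ⊛ s ⊕ (b ⊛ s ⊕ c ⊛ s) ⊜ (a ⊕ (b ⊕ c)) ⊛ s) refl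
               ⟦ f y Fin.≟ f x ⟧ ⟦ f y Fin.≟ rot (f x) ⟧ ⟦ f y Fin.≟ rot (rot (f x)) ⟧
               (satisfied L f))
             (trans (cong (ℕ._* satisfied L f) (offsets-partition (f x) (f y)))
               (ℕ.*-identityˡ (satisfied L f)))) ⟩
      ∑ᶠ n (satisfied L) ∎
      where
      open ≡-Reasoning
      term : (Fin 3 → Fin 3) → (Fin n → Fin 3) → ℕ
      term ρ f = ⟦ f y Fin.≟ ρ (f x) ⟧ ℕ.* satisfied L f

module _ (B : OrientedGraph) where
  open OrientedGraph B

  -- The new edge closes the path. Length 0 would make it a loop; length 1 would make it either a
  -- repeated edge or the reverse of one, against freshness or asymmetry.
  path⇒cycle : ∀ {L x y} → x ⟶ y → All (uncurry _⟶_) L → All ((x , y) ≢_) L →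
    SimplePath (SymClosure (Listed L)) x y → Cycle (underlying B)
  path⇒cycle x⟶y _ _ record { len = 0 ; start = refl ; end = refl } =
    contradiction x⟶y λ h → asymmetric h h
  path⇒cycle x⟶y es fresh record { len = 1 ; step = step ; start = refl ; end = refl }
    with step zero
  ... | fwd xy∈L = contradiction refl (All.lookup fresh xy∈L)
  ... | bwd yx∈L = contradiction (All.lookup es yx∈L) (asymmetric x⟶y)
  path⇒cycle x⟶y es _ record
    { len = suc (suc k) ; at = c ; injective = inj ; step = step
    ; start = refl ; end = refl } = record
    { k = suc (suc k) ; k≥2 = ℕ.s≤s (ℕ.s≤s ℕ.z≤n) ; c = c ; injective = inj
    ; step = adjacent ∘ step ; close = inj₂ x⟶y }
    where
    adjacent : ∀ {a b} → SymClosure (Listed _) a b → a ⟶ b ⊎ b ⟶ a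
    adjacent (fwd ab∈L) = inj₁ (All.lookup es ab∈L)
    adjacent (bwd ba∈L) = inj₂ (All.lookup es ba∈L)

  -- Edges are added one at a time. One whose ends are already connected yields a cycle; any other
  -- divides the count by three, starting from all 3^v(B) maps.
  cycle-or-count : ∀ L → All (uncurry _⟶_) L → Unique L →
    Cycle (underlying B) ⊎ ∑ᶠ order (satisfied L) ℕ.* 3 ℕ.^ length L ≡ 3 ℕ.^ order
  cycle-or-count [] [] [] = inj₂ (trans (ℕ.*-identityʳ _)
    (trans (∑ᶠ-const order 1) (ℕ.*-identityʳ _)))
  cycle-or-count ((x , y) ∷ L) (x⟶y ∷ es) (fresh ∷ uniq) with label L x Fin.≟ label L y
  ... | yes eq = inj₁ (path⇒cycle x⟶y es fresh (simplePath (label≡⇒connected L eq)))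
  ... | no x≢y = Sum.map₂ (λ eq → begin
      ∑ᶠ order (satisfied ((x , y) ∷ L)) ℕ.* (3 ℕ.* 3 ℕ.^ length L)
        ≡⟨ sym (ℕ.*-assoc (∑ᶠ order (satisfied ((x , y) ∷ L))) 3 (3 ℕ.^ length L)) ⟩
      ∑ᶠ order (satisfied ((x , y) ∷ L)) ℕ.* 3 ℕ.* 3 ℕ.^ length L
        ≡⟨ cong (ℕ._* 3 ℕ.^ length L) (bridge-thirds L x y x≢y) ⟩
      ∑ᶠ order (satisfied L) ℕ.* 3 ℕ.^ length L
        ≡⟨ eq ⟩
      3 ℕ.^ order ∎) (cycle-or-count L es uniq)
    where open ≡-Reasoning

  edge∈edges : ∀ {x y} → x ⟶ y → (x , y) ∈ edges
  edge∈edges x⟶y = ∈-filter⁺ (uncurry _⟶?_) (∈-cartesianProduct⁺ (∈-allFin _) (∈-allFin _)) x⟶y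

  edges-adjacent : All (uncurry _⟶_) edges
  edges-adjacent = All.tabulate (λ xy∈ → proj₂ (∈-filter⁻ (uncurry _⟶?_)
    {xs = cartesianProduct (allFin order) (allFin order)} xy∈))

  edges-unique : Unique edges
  edges-unique = Unique.filter⁺ (uncurry _⟶?_)
    (Unique.cartesianProduct⁺ (Unique.allFin⁺ order) (Unique.allFin⁺ order))

  hom-C⃗₃ : hom B C⃗₃ ≡ ∑ᶠ order (satisfied edges)
  hom-C⃗₃ = trans (hom≡∑ᶠ B C⃗₃) (∑ᶠ-cong order (λ f → ⟦⟧-cong
    (isHomomorphism? B C⃗₃ f) (All.all? (follows? f) edges)
    (λ h → All.map (λ {(x , y)} → h x y) edges-adjacent)
    (λ all x y x⟶y → All.lookup all (edge∈edges x⟶y))))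

  forcing⇒cycle : DirectedForcing B → Cycle (underlying B)
  forcing⇒cycle forcing = Sum.fromInj₁ (λ count → contradiction forcing (obstruction count))
    (cycle-or-count edges edges-adjacent edges-unique)
    where
    -- The triangle has edge density 3/9 = 1/3, so p = 2/3. A block of length 1/3 consists of vertex
    -- 0 alone, which has no loop.
    ⅓ ⅔ : ℚ
    ⅓ = + 1 ℚ./ 3
    ⅔ = + 2 ℚ./ 3
    origin-loopless : SpansNoEdges (OrientedGraph.digraph C⃗₃) ⅓
    origin-loopless zero zero _ _ ()
    origin-loopless zero (suc zero) _ lt _ = ℚ.<-irrefl refl lt
    origin-loopless (suc zero) _ lt _ _ = ℚ.<-irrefl refl lt
    origin-loopless (suc (suc zero)) _ lt _ _ = ℚ.<-asym lt (<-from-gap ⅓ (ℚ.positive⁻¹ ⅓) refl)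
    obstruction : ∑ᶠ order (satisfied edges) ℕ.* 3 ℕ.^ e B ≡ 3 ℕ.^ order → ¬ DirectedForcing B
    obstruction count = block-obstructs-forcing B
      (ℚ.positive⁻¹ ⅔) (≤-from-gap ⅓ (ℚ.nonNegative⁻¹ ⅓) refl)
      (ℚ.positive⁻¹ ⅓) (≤-from-gap ⅔ (ℚ.nonNegative⁻¹ ⅔) refl)
      (λ _ → C⃗₃) (λ _ → homDensity≡t K⃗₂ C⃗₃)
      (⟶ℚ-const (λ _ → homDensity B C⃗₃) ((⅔ ℚ.* ½) ^ℚ e B) (λ _ → trans
        (homDensity≡ratio B C⃗₃ (1 ℕ.^ e B) (3 ℕ.^ e B) {{ℕ.m^n≢0 3 (e B)}}
          (trans (cong (ℕ._* 3 ℕ.^ e B) hom-C⃗₃) (trans count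
            (trans (sym (ℕ.*-identityˡ (3 ℕ.^ order)))
            (cong (ℕ._* 3 ℕ.^ order) (sym (ℕ.^-zeroˡ (e B))))))))
        (sym (/-^ 1 3 (e B) {{_}} {{ℕ.m^n≢0 3 (e B)}}))))
      (λ _ → origin-loopless)

-- Products of indicators and a discrete intermediate value theorem

⟦⟧-mono : ∀ {P Q : Set} (P? : Dec P) (Q? : Dec Q) → (P → Q) → ⟦ P? ⟧ ℕ.≤ ⟦ Q? ⟧
⟦⟧-mono (no _)  Q? _   = ℕ.z≤n
⟦⟧-mono (yes p) Q? p⇒q = ℕ.≤-reflexive (sym (⟦⟧-yes Q? (p⇒q p)))

product-⟦⟧ : ∀ {n} {P : Fin n → Set} (P? : ∀ u → Dec (P u)) (all? : Dec (∀ u → P u)) →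
  product (λ u → ⟦ P? u ⟧) ≡ ⟦ all? ⟧
product-⟦⟧ P? (yes all) = product-1 (λ u → ⟦⟧-yes (P? u) (all u))
product-⟦⟧ {P = P} P? (no ¬all) =
  let u , ¬Pu = Fin.¬∀⟶∃¬ _ P P? ¬all in product-0 u (⟦⟧-no (P? u) ¬Pu)

product-const : ∀ n c → product {n} (λ _ → c) ≡ c ℕ.^ n
product-const zero    c = refl
product-const (suc n) c = cong (c ℕ.*_) (product-const n c)

product-^ : ∀ {n} c (k : Fin n → ℕ) → product (λ u → c ℕ.^ k u) ≡ c ℕ.^ sum k
product-^ {zero}  c k = refl
product-^ {suc n} c k = trans (cong (c ℕ.^ k zero ℕ.*_) (product-^ c (k ∘ suc)))
  (sym (ℕ.^-distribˡ-+-* c (k zero) (sum (k ∘ suc))))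

sum-indicator : ∀ {n} (i : Fin n) → sum (λ j → ⟦ j Fin.≟ i ⟧) ≡ 1
sum-indicator {suc n} zero    = cong suc (trans
  (sum-cong-≗ {n} (λ j → ⟦⟧-no (suc j Fin.≟ zero) λ ()))
  (trans (sum-const n 0) (ℕ.*-zeroʳ n)))
sum-indicator {suc n} (suc i) = trans (sum-cong-≗ {n} (λ j →
  ⟦⟧-cong (suc j Fin.≟ suc i) (j Fin.≟ i) Fin.suc-injective (cong suc)))
  (sum-indicator i)

sum-indicator-toℕ : ∀ n j → sum {n} (λ i → ⟦ toℕ i ℕ.≟ j ⟧) ℕ.≤ 1
sum-indicator-toℕ zero    j       = ℕ.z≤n
sum-indicator-toℕ (suc n) zero    = ℕ.≤-reflexive (cong suc
  (trans (sum-cong-≗ {n} (λ i → ⟦⟧-no (suc (toℕ i) ℕ.≟ 0) λ ()))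
    (trans (sum-const n 0) (ℕ.*-zeroʳ n))))
sum-indicator-toℕ (suc n) (suc j) = subst (ℕ._≤ 1)
  (sum-cong-≗ {n} (λ i → ⟦⟧-cong (toℕ i ℕ.≟ j) (suc (toℕ i) ℕ.≟ suc j) (cong suc) ℕ.suc-injective))
  (sum-indicator-toℕ n j)

-- Descending from `k` while the value stays at least θ, the search stops at 0 or where the
-- preceding value is at most θ; there the overshoot is at most one step.
discrete-IVT : ∀ (τ : ℕ → ℚ) {θ δ} → (∀ j → τ (suc j) ℚ.≤ τ j ℚ.+ δ) → τ 0 ℚ.≤ θ → 0ℚ ℚ.≤ δ →
  ∀ k → θ ℚ.≤ τ k → ∃[ j ] θ ℚ.≤ τ j × τ j ℚ.≤ θ ℚ.+ δ
discrete-IVT τ {θ} {δ} step τ₀≤θ 0≤δ zero    θ≤τ₀ =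
  0 , θ≤τ₀ , ℚ.≤-trans τ₀≤θ (≤-from-gap δ 0≤δ refl)
discrete-IVT τ {θ} {δ} step τ₀≤θ 0≤δ (suc k) θ≤τ  = Sum.[
  discrete-IVT τ step τ₀≤θ 0≤δ k ,
  (λ τₖ≤θ → suc k , θ≤τ , ℚ.≤-trans (step k) (ℚ.+-monoˡ-≤ δ τₖ≤θ)) ] (ℚ.≤-total θ (τ k))

reciprocals-vanish : ∀ s ε → 0ℚ ℚ.< ε → ∃[ N ] ∀ n → N ℕ.≤ n → + s ℚ./ suc n ℚ.≤ ε
reciprocals-vanish s (ℚ.mkℚ (+ zero) d c) (ℚ.*<* (ℤ.+<+ ()))
reciprocals-vanish s (ℚ.mkℚ -[1+ a ] d c) (ℚ.*<* ())
-- Here ε = (a + 1)/(d + 1) is at least 1/(d + 1), so N = s(d + 1) suffices.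
reciprocals-vanish s ε@(ℚ.mkℚ (+ suc a) d c) _ = s ℕ.* suc d , λ n N≤n →
  subst (+ s ℚ./ suc n ℚ.≤_) (ℚ.↥p/↧p≡p ε) (/-mono-≤ s (suc n) (suc a) (suc d)
    (ℕ.≤-trans N≤n (ℕ.≤-trans (ℕ.n≤1+n n) (ℕ.m≤m+n (suc n) (a ℕ.* suc n)))))

-- Graphs with a directed path of length two

module _ (c s k : ℕ) where

  -- Vertices code triples of a copy, a vertex of B and a level. The copy is the leading digit, so
  -- that copy 0 occupies the initial block [0,1/c).
  copy : Fin (c ℕ.* (s ℕ.* k)) → Fin c
  copy i = proj₁ (remQuot (s ℕ.* k) i)

  vertex : Fin (c ℕ.* (s ℕ.* k)) → Fin s
  vertex i = proj₁ (remQuot {s} k (proj₂ (remQuot {c} (s ℕ.* k) i)))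

  level : Fin (c ℕ.* (s ℕ.* k)) → Fin k
  level i = proj₂ (remQuot {s} k (proj₂ (remQuot {c} (s ℕ.* k) i)))

  sum-decode : ∀ (h : Fin c → Fin s → Fin k → ℕ) →
    sum (λ i → h (copy i) (vertex i) (level i)) ≡ sum (λ a → sum (λ x → sum (λ l → h a x l)))
  sum-decode h = trans (sum-combine c (s ℕ.* k) _) (sum-cong-≗ {c} λ a →
    trans (sum-cong-≗ {s ℕ.* k} λ r →
      cong (λ p → h (proj₁ p) (proj₁ (remQuot {s} k (proj₂ p))) (proj₂ (remQuot {s} k (proj₂ p))))
            (Fin.remQuot-combine {c} a r))
    (trans (sum-combine s k _) (sum-cong-≗ {s} λ x → sum-cong-≗ {k} λ l →
      cong (λ p → h a (proj₁ p) (proj₂ p)) (Fin.remQuot-combine {s} x l))))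

  copy-lower-bound : ∀ i → s ℕ.* k ℕ.* toℕ (copy i) ℕ.≤ toℕ i
  copy-lower-bound i = subst (s ℕ.* k ℕ.* toℕ (copy i) ℕ.≤_)
    (trans (sym (Fin.toℕ-combine (copy i) (proj₂ (remQuot {c} (s ℕ.* k) i))))
      (cong toℕ (Fin.combine-remQuot {c} (s ℕ.* k) i)))
    (ℕ.m≤m+n _ _)

square-^ : ∀ m k → (m ℕ.* m) ℕ.^ k ≡ m ℕ.^ (k ℕ.+ k)
square-^ m k = trans (cong (λ r → (m ℕ.* r) ℕ.^ k) (sym (ℕ.*-identityʳ m)))
  (trans (ℕ.^-*-assoc m 2 k) (cong (λ r → m ℕ.^ (k ℕ.+ r)) (ℕ.+-identityʳ k)))

module Interpolation (B : OrientedGraph) where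
  open OrientedGraph B renaming (order to s)

  -- c ≥ 2 e(B) makes the edge density e(B)/(cs)² at most 1/2, and c ≥ e(B)^e(B)
  -- makes the B-density of the last graph at least its e(B)-th power.
  c′ c cs : ℕ
  c′ = e B ℕ.* 2 ℕ.+ e B ℕ.^ e B
  c = suc (suc c′)
  cs = c ℕ.* s

  target : ℕ → ℕ → Fin c
  target j l = if does (l ℕ.<? j) then suc zero else zero

  instance
    cs≢0 : ℕ.NonZero cs
    cs≢0 = ℕ.m*n≢0 c s
    cs²≢0 : ℕ.NonZero (cs ℕ.* cs)
    cs²≢0 = ℕ.m*n≢0 cs cs

  Touched : Fin s → Set
  Touched u = ∃[ w ] (u ⟶ w ⊎ w ⟶ u)

  touched? : ∀ u → Dec (Touched u)
  touched? u = Fin.any? (λ w → (u ⟶? w) ⊎-dec (w ⟶? u))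

  outdegree indegree : Fin s → ℕ
  outdegree x = sum (λ y → ⟦ x ⟶? y ⟧)
  indegree  y = sum (λ x → ⟦ x ⟶? y ⟧)

  outdegree≥1 : ∀ {x y} → x ⟶ y → 1 ℕ.≤ outdegree x
  outdegree≥1 {x} {y} x⟶y = ℕ.≤-trans
    (ℕ.≤-reflexive (sym (⟦⟧-yes (x ⟶? y) x⟶y))) (term≤sum (λ y → ⟦ x ⟶? y ⟧) y)

  indegree≥1 : ∀ {x y} → x ⟶ y → 1 ℕ.≤ indegree y
  indegree≥1 {x} {y} x⟶y = ℕ.≤-trans
    (ℕ.≤-reflexive (sym (⟦⟧-yes (x ⟶? y) x⟶y))) (term≤sum (λ x → ⟦ x ⟶? y ⟧) x)

  touched≤degree : ∀ u → ⟦ touched? u ⟧ ℕ.≤ outdegree u ℕ.+ indegree u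
  touched≤degree u = bound (touched? u)
    where
    bound : ∀ (D : Dec (Touched u)) → ⟦ D ⟧ ℕ.≤ outdegree u ℕ.+ indegree u
    bound (yes (w , inj₁ u⟶w)) = ℕ.m≤n⇒m≤n+o (indegree u) (outdegree≥1 u⟶w)
    bound (yes (w , inj₂ w⟶u)) = ℕ.m≤n⇒m≤o+n (outdegree u) (indegree≥1 w⟶u)
    bound (no _)               = ℕ.z≤n

  -- Out- and indegrees add up to 2 e(B). Each touched vertex contributes at least one, and `y` at
  -- least two, which makes the inequality strict.
  touched-count : ∀ {x y z} → x ⟶ y → y ⟶ z → sum (λ u → ⟦ touched? u ⟧) ℕ.< e B ℕ.+ e B
  touched-count {x} {y} {z} x⟶y y⟶z = subst (sum (λ u → ⟦ touched? u ⟧) ℕ.<_)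
    (trans (∑-distrib-+ {s} outdegree indegree)
      (cong₂ ℕ._+_ (sym (e≡∑∑ B)) (trans (∑-comm {s} {s} (λ y x → ⟦ x ⟶? y ⟧)) (sym (e≡∑∑ B)))))
    (sum-mono-< touched≤degree y (ℕ.≤-trans (ℕ.s≤s (⟦⟧≤1 (touched? y)))
      (ℕ.+-mono-≤ (outdegree≥1 y⟶z) (indegree≥1 x⟶y))))

  module _ (k : ℕ) {{k≢0 : ℕ.NonZero k}} where

    n : ℕ
    n = c ℕ.* (s ℕ.* k)

    instance
      sk≢0 : ℕ.NonZero (s ℕ.* k)
      sk≢0 = ℕ.m*n≢0 s k
      n≢0 : ℕ.NonZero n
      n≢0 = ℕ.m*n≢0 c (s ℕ.* k)

    copyₖ : Fin n → Fin c
    copyₖ = copy c s k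
    vertexₖ : Fin n → Fin s
    vertexₖ = vertex c s k
    levelₖ : Fin n → ℕ
    levelₖ i = toℕ (level c s k i)

    Arc : ℕ → Fin n → Fin n → Set
    Arc j i i′ = copyₖ i ≡ suc zero × vertexₖ i ⟶ vertexₖ i′ × copyₖ i′ ≡ target j (levelₖ i)

    arc? : ∀ j i i′ → Dec (Arc j i i′)
    arc? j i i′ = (copyₖ i Fin.≟ suc zero) ×-dec
      ((vertexₖ i ⟶? vertexₖ i′) ×-dec (copyₖ i′ Fin.≟ target j (levelₖ i)))

    -- Copy 1 carries the blow-up of B, but the edges leaving a vertex of level
    -- ≥ j are redirected into copy 0; all other copies are isolated.
    graph : ℕ → OrientedGraph
    graph j = record
      { digraph    = record { order = n ; _⟶_ = Arc j ; _⟶?_ = arc? j }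
      ; asymmetric = λ { (_ , x⟶y , _) (_ , y⟶x , _) → asymmetric x⟶y y⟶x }
      }

    -- For every tail in copy 1 the heads lie in exactly one copy. Redirection changes which copy
    -- that is but not the number of heads, so `j` drops out.
    edge-count : ∀ j → hom K⃗₂ (graph j) ≡ e B ℕ.* (k ℕ.* k)
    edge-count j = begin
      hom K⃗₂ (graph j)
        ≡⟨ hom-K⃗₂ (graph j) ⟩
      sum (λ i → sum (λ i′ → ⟦ arc? j i i′ ⟧))
        ≡⟨ sum-cong-≗ {n} (λ i → trans (sum-cong-≗ {n} (λ i′ → factor i i′))
             (sum-decode c s k (λ a′ y l′ → A (copyₖ i) ℕ.* (⟦ vertexₖ i ⟶? y ⟧ ℕ.* T i a′)))) ⟩
      sum (λ i → sum (λ a′ → sum (λ y → sum {k} (λ l′ →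
        A (copyₖ i) ℕ.* (⟦ vertexₖ i ⟶? y ⟧ ℕ.* T i a′)))))
        ≡⟨ sum-cong-≗ {n} (λ i → heads i) ⟩
      sum (λ i → k ℕ.* A (copyₖ i) ℕ.* outdegree (vertexₖ i))
        ≡⟨ sum-decode c s k (λ a x l → k ℕ.* A a ℕ.* outdegree x) ⟩
      sum (λ a → sum (λ x → sum {k} (λ l → k ℕ.* A a ℕ.* outdegree x)))
        ≡⟨ sum-cong-≗ {c} (λ a → trans (sum-cong-≗ {s} (λ x → trans
               (sum-const k (k ℕ.* A a ℕ.* outdegree x))
               (sym (ℕ.*-assoc k (k ℕ.* A a) (outdegree x)))))
             (trans (sym (*-distribˡ-sum {s} (k ℕ.* (k ℕ.* A a)) outdegree))
               (trans (cong (k ℕ.* (k ℕ.* A a) ℕ.*_) (sym (e≡∑∑ B)))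
                 (solveℕ 3 (λ k a e → k ⊛ (k ⊛ a) ⊛ e ⊜ e ⊛ (k ⊛ k) ⊛ a) refl k (A a) (e B))))) ⟩
      sum (λ a → e B ℕ.* (k ℕ.* k) ℕ.* A a)
        ≡⟨ sym (*-distribˡ-sum {c} (e B ℕ.* (k ℕ.* k)) A) ⟩
      e B ℕ.* (k ℕ.* k) ℕ.* sum A
        ≡⟨ trans (cong (e B ℕ.* (k ℕ.* k) ℕ.*_) (sum-indicator {c} (suc zero))) (ℕ.*-identityʳ _) ⟩
      e B ℕ.* (k ℕ.* k) ∎
      where
      open ≡-Reasoning
      A : Fin c → ℕ
      A a = ⟦ a Fin.≟ suc zero ⟧
      T : Fin n → Fin c → ℕ
      T i a′ = ⟦ a′ Fin.≟ target j (levelₖ i) ⟧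
      factor : ∀ i i′ →
        ⟦ arc? j i i′ ⟧ ≡ A (copyₖ i) ℕ.* (⟦ vertexₖ i ⟶? vertexₖ i′ ⟧ ℕ.* T i (copyₖ i′))
      factor i i′ = trans (⟦⟧-× (copyₖ i Fin.≟ suc zero)
          ((vertexₖ i ⟶? vertexₖ i′) ×-dec (copyₖ i′ Fin.≟ target j (levelₖ i))))
        (cong (A (copyₖ i) ℕ.*_)
          (⟦⟧-× (vertexₖ i ⟶? vertexₖ i′) (copyₖ i′ Fin.≟ target j (levelₖ i))))
      heads : ∀ i → sum (λ a′ → sum (λ y → sum {k} (λ l′ →
        A (copyₖ i) ℕ.* (⟦ vertexₖ i ⟶? y ⟧ ℕ.* T i a′)))) ≡
        k ℕ.* A (copyₖ i) ℕ.* outdegree (vertexₖ i)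
      heads i = trans (sum-cong-≗ {c} (λ a′ → trans (sum-cong-≗ {s} (λ y → trans
            (sum-const k (A (copyₖ i) ℕ.* (⟦ vertexₖ i ⟶? y ⟧ ℕ.* T i a′)))
            (solveℕ 4 (λ k a x d → k ⊛ (a ⊛ (x ⊛ d)) ⊜ k ⊛ a ⊛ d ⊛ x)
              refl k (A (copyₖ i)) ⟦ vertexₖ i ⟶? y ⟧ (T i a′))))
          (trans (sym (*-distribˡ-sum {s} (k ℕ.* A (copyₖ i) ℕ.* T i a′)
            (λ y → ⟦ vertexₖ i ⟶? y ⟧)))
            (solveℕ 4 (λ k a d o → k ⊛ a ⊛ d ⊛ o ⊜ k ⊛ a ⊛ o ⊛ d)
              refl k (A (copyₖ i)) (T i a′) (outdegree (vertexₖ i))))))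
        (trans (sym (*-distribˡ-sum {c} (k ℕ.* A (copyₖ i) ℕ.* outdegree (vertexₖ i)) (T i)))
          (trans (cong (k ℕ.* A (copyₖ i) ℕ.* outdegree (vertexₖ i) ℕ.*_)
            (sum-indicator {c} (target j (levelₖ i))))
            (ℕ.*-identityʳ _)))

    H : ℕ → ℕ
    H j = hom B (graph j)

    homIndicator : ℕ → (Fin s → Fin n) → ℕ
    homIndicator j f = ⟦ isHomomorphism? B (graph j) f ⟧

    hits : ℕ → (Fin s → Fin n) → Fin s → ℕ
    hits j f u = ⟦ levelₖ (f u) ℕ.≟ j ⟧

    target-step : ∀ j l → l ≢ j → target (suc j) l ≡ target j l
    target-step j l l≢j = cong (λ b → if b then suc zero else zero) (does-⇔
      (mk⇔ (λ l<1+j → ℕ.≤∧≢⇒< (ℕ.≤-pred l<1+j) l≢j) ℕ.m<n⇒m<1+n)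
      (l ℕ.<? suc j) (l ℕ.<? j))

    -- The two graphs differ only in the edges leaving vertices of level `j`, so a map that is a
    -- homomorphism only to the later graph must hit that level.
    homIndicator-step : ∀ j f → homIndicator (suc j) f ℕ.≤ homIndicator j f ℕ.+ sum (hits j f)
    homIndicator-step j f = split (Fin.any? (λ u → levelₖ (f u) ℕ.≟ j))
      where
      split : Dec (∃[ u ] levelₖ (f u) ≡ j) →
        homIndicator (suc j) f ℕ.≤ homIndicator j f ℕ.+ sum (hits j f)
      split (yes (u , hit)) = begin
        homIndicator (suc j) f              ≤⟨ ⟦⟧≤1 (isHomomorphism? B (graph (suc j)) f) ⟩
        1                                   ≡⟨ sym (⟦⟧-yes (levelₖ (f u) ℕ.≟ j) hit) ⟩
        hits j f u                          ≤⟨ term≤sum (hits j f) u ⟩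
        sum (hits j f)                      ≤⟨ ℕ.m≤n+m _ (homIndicator j f) ⟩
        homIndicator j f ℕ.+ sum (hits j f) ∎
        where open ℕ.≤-Reasoning
      split (no miss) = ℕ.≤-trans
        (⟦⟧-mono (isHomomorphism? B (graph (suc j)) f) (isHomomorphism? B (graph j) f) λ h x y x⟶y →
          let a , b , eq = h x y x⟶y in
          a , b , trans eq (target-step j (levelₖ (f x)) (λ hit → miss (x , hit))))
        (ℕ.m≤m+n (homIndicator j f) _)

    -- A level holds a proportion 1/k of the vertices, or none once j ≥ k.
    level-count : ∀ j → sum (λ i → ⟦ levelₖ i ℕ.≟ j ⟧) ℕ.* k ℕ.≤ n
    level-count j = begin
      sum (λ i → ⟦ levelₖ i ℕ.≟ j ⟧) ℕ.* k
        ≡⟨ cong (ℕ._* k) (trans (sum-decode c s k (λ _ _ l → ⟦ toℕ l ℕ.≟ j ⟧))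
             (trans (sum-const c (sum {s} (λ _ → levels))) (cong (c ℕ.*_) (sum-const s levels)))) ⟩
      c ℕ.* (s ℕ.* sum {k} (λ l → ⟦ toℕ l ℕ.≟ j ⟧)) ℕ.* k
        ≤⟨ ℕ.*-monoˡ-≤ k (ℕ.*-monoʳ-≤ c (ℕ.*-monoʳ-≤ s (sum-indicator-toℕ k j))) ⟩
      c ℕ.* (s ℕ.* 1) ℕ.* k
        ≡⟨ solveℕ 3 (λ c s k → c ⊛ (s ⊛ lit 1) ⊛ k ⊜ c ⊛ (s ⊛ k)) refl c s k ⟩
      n ∎
      where
      open ℕ.≤-Reasoning
      levels : ℕ
      levels = sum {k} (λ l → ⟦ toℕ l ℕ.≟ j ⟧)

    hits-bound : ∀ j u → ∑ᶠ s (λ f → hits j f u) ℕ.* k ℕ.≤ n ℕ.^ s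
    hits-bound j u = ℕ.*-cancelˡ-≤ n (begin
      n ℕ.* (∑ᶠ s (λ f → hits j f u) ℕ.* k)
        ≡⟨ sym (ℕ.*-assoc n _ k) ⟩
      n ℕ.* ∑ᶠ s (λ f → hits j f u) ℕ.* k
        ≡⟨ cong (ℕ._* k) (∑ᶠ-coordinate s (λ i → ⟦ levelₖ i ℕ.≟ j ⟧) u) ⟩
      n ℕ.^ s ℕ.* sum (λ i → ⟦ levelₖ i ℕ.≟ j ⟧) ℕ.* k
        ≡⟨ ℕ.*-assoc (n ℕ.^ s) _ k ⟩
      n ℕ.^ s ℕ.* (sum (λ i → ⟦ levelₖ i ℕ.≟ j ⟧) ℕ.* k)
        ≤⟨ ℕ.*-monoʳ-≤ (n ℕ.^ s) (level-count j) ⟩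
      n ℕ.^ s ℕ.* n
        ≡⟨ ℕ.*-comm (n ℕ.^ s) n ⟩
      n ℕ.* n ℕ.^ s ∎)
      where open ℕ.≤-Reasoning

    -- A union bound: each of the `s` vertices of B is sent to level `j` by at most a proportion 1/k
    -- of all maps.
    H-step : ∀ j → H (suc j) ℕ.* k ℕ.≤ H j ℕ.* k ℕ.+ s ℕ.* n ℕ.^ s
    H-step j = begin
      H (suc j) ℕ.* k
        ≡⟨ cong (ℕ._* k) (hom≡∑ᶠ B (graph (suc j))) ⟩
      ∑ᶠ s (homIndicator (suc j)) ℕ.* k
        ≤⟨ ℕ.*-monoˡ-≤ k (∑ᶠ-mono s (homIndicator-step j)) ⟩
      ∑ᶠ s (λ f → homIndicator j f ℕ.+ sum (hits j f)) ℕ.* k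
        ≡⟨ cong (ℕ._* k) (trans (∑ᶠ-+ s (homIndicator j) (λ f → sum (hits j f)))
             (cong₂ ℕ._+_ (sym (hom≡∑ᶠ B (graph j))) (∑ᶠ-sum s (λ u f → hits j f u)))) ⟩
      (H j ℕ.+ sum (λ u → ∑ᶠ s (λ f → hits j f u))) ℕ.* k
        ≡⟨ ℕ.*-distribʳ-+ k (H j) _ ⟩
      H j ℕ.* k ℕ.+ sum (λ u → ∑ᶠ s (λ f → hits j f u)) ℕ.* k
        ≡⟨ cong (H j ℕ.* k ℕ.+_) (*-distribʳ-sum {s} k (λ u → ∑ᶠ s (λ f → hits j f u))) ⟩
      H j ℕ.* k ℕ.+ sum (λ u → ∑ᶠ s (λ f → hits j f u) ℕ.* k)
        ≤⟨ ℕ.+-monoʳ-≤ (H j ℕ.* k) (sum-mono (hits-bound j)) ⟩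
      H j ℕ.* k ℕ.+ sum {s} (λ _ → n ℕ.^ s)
        ≡⟨ cong (H j ℕ.* k ℕ.+_) (sum-const s (n ℕ.^ s)) ⟩
      H j ℕ.* k ℕ.+ s ℕ.* n ℕ.^ s ∎
      where open ℕ.≤-Reasoning

    -- In `graph 0` all edges run from copy 1 to copy 0, so the image of `y` would lie in both.
    H-start : ∀ {x y z} → x ⟶ y → y ⟶ z → H 0 ≡ 0
    H-start {x} {y} {z} x⟶y y⟶z = trans (hom≡∑ᶠ B (graph 0)) (trans
      (∑ᶠ-cong s (λ f → ⟦⟧-no (isHomomorphism? B (graph 0) f) (λ h →
        Fin.0≢1+n (trans (sym (proj₂ (proj₂ (h x y x⟶y)))) (proj₁ (h y z y⟶z))))))
      (trans (∑ᶠ-const {n} s 0) (ℕ.*-zeroʳ (n ℕ.^ s))))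

    -- The maps counted for the lower bound on `H k` send each touched vertex into its own class in
    -- copy 1 and isolated vertices anywhere.
    placed? : ∀ u i → Dec (Touched u → copyₖ i ≡ suc zero × vertexₖ i ≡ u)
    placed? u i = touched? u →-dec ((copyₖ i Fin.≟ suc zero) ×-dec (vertexₖ i Fin.≟ u))

    -- A touched vertex has `k` choices and k · cs = n; an isolated one has all `n`. The exponent
    -- unites the two cases, ready for a product over `u`.
    placements : ∀ u → sum (λ i → ⟦ placed? u i ⟧) ℕ.* cs ℕ.^ ⟦ touched? u ⟧ ≡ n
    placements u = count (touched? u)
      where
      open ≡-Reasoning
      A : Fin c → ℕ
      A a = ⟦ a Fin.≟ suc zero ⟧
      count : ∀ (D : Dec (Touched u)) →
        sum (λ i → ⟦ D →-dec ((copyₖ i Fin.≟ suc zero) ×-dec (vertexₖ i Fin.≟ u)) ⟧)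
          ℕ.* cs ℕ.^ ⟦ D ⟧ ≡ n
      count (no _)  = trans (cong (ℕ._* 1) (sum-const n 1))
        (trans (ℕ.*-identityʳ (n ℕ.* 1)) (ℕ.*-identityʳ n))
      count (yes _) = trans (cong (ℕ._* (cs ℕ.* 1)) (begin
        sum (λ i → ⟦ (copyₖ i Fin.≟ suc zero) ×-dec (vertexₖ i Fin.≟ u) ⟧)
          ≡⟨ sum-cong-≗ {n} (λ i → ⟦⟧-× (copyₖ i Fin.≟ suc zero) (vertexₖ i Fin.≟ u)) ⟩
        sum (λ i → A (copyₖ i) ℕ.* ⟦ vertexₖ i Fin.≟ u ⟧)
          ≡⟨ sum-decode c s k (λ a x _ → A a ℕ.* ⟦ x Fin.≟ u ⟧) ⟩
        sum (λ a → sum (λ x → sum {k} (λ _ → A a ℕ.* ⟦ x Fin.≟ u ⟧)))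
          ≡⟨ sum-cong-≗ {c} (λ a → trans
               (sum-cong-≗ {s} (λ x → trans (sum-const k (A a ℕ.* ⟦ x Fin.≟ u ⟧))
                 (sym (ℕ.*-assoc k (A a) ⟦ x Fin.≟ u ⟧))))
               (trans (sym (*-distribˡ-sum {s} (k ℕ.* A a) (λ x → ⟦ x Fin.≟ u ⟧)))
                 (trans (cong (k ℕ.* A a ℕ.*_) (sum-indicator {s} u))
                   (ℕ.*-identityʳ (k ℕ.* A a))))) ⟩
        sum (λ a → k ℕ.* A a)
          ≡⟨ trans (sym (*-distribˡ-sum {c} k A))
               (trans (cong (k ℕ.*_) (sum-indicator {c} (suc zero))) (ℕ.*-identityʳ k)) ⟩
        k ∎)) (solveℕ 3 (λ k c s → k ⊛ (c ⊛ s ⊛ lit 1) ⊜ c ⊛ (s ⊛ k)) refl k c s)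

    placed⇒hom : ∀ f → (∀ u → Touched u → copyₖ (f u) ≡ suc zero × vertexₖ (f u) ≡ u) →
      IsHomomorphism B (graph k) f
    placed⇒hom f placed x y x⟶y =
      let copy-x , vertex-x = placed x (y , inj₁ x⟶y)
          copy-y , vertex-y = placed y (x , inj₂ x⟶y) in
      copy-x , subst₂ _⟶_ (sym vertex-x) (sym vertex-y) x⟶y ,
      -- All levels are below `k`, so `graph k` redirects nothing.
      trans copy-y (sym (cong (λ b → if b then suc zero else zero)
        (dec-true (levelₖ (f x) ℕ.<? k) (Fin.toℕ<n (level c s k (f x))))))

    H-end-touched : n ℕ.^ s ℕ.≤ H k ℕ.* cs ℕ.^ sum (λ u → ⟦ touched? u ⟧)
    H-end-touched = begin
      n ℕ.^ s
        ≡⟨ sym (product-const s n) ⟩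
      product {s} (λ _ → n)
        ≡⟨ product-cong {s} (λ u → sym (placements u)) ⟩
      product (λ u → sum (λ i → ⟦ placed? u i ⟧) ℕ.* cs ℕ.^ ⟦ touched? u ⟧)
        ≡⟨ product-distrib-* {s} (λ u → sum (λ i → ⟦ placed? u i ⟧)) (λ u → cs ℕ.^ ⟦ touched? u ⟧) ⟩
      product (λ u → sum (λ i → ⟦ placed? u i ⟧)) ℕ.* product (λ u → cs ℕ.^ ⟦ touched? u ⟧)
        ≡⟨ cong₂ ℕ._*_ (sym (∑ᶠ-product s (λ u i → ⟦ placed? u i ⟧)))
             (product-^ cs (λ u → ⟦ touched? u ⟧)) ⟩
      ∑ᶠ s (λ f → product (λ u → ⟦ placed? u (f u) ⟧)) ℕ.* cs ℕ.^ sum (λ u → ⟦ touched? u ⟧)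
        ≤⟨ ℕ.*-monoˡ-≤ _ (∑ᶠ-mono s (λ f → ℕ.≤-trans
             (ℕ.≤-reflexive (product-⟦⟧ (λ u → placed? u (f u)) (Fin.all? (λ u → placed? u (f u)))))
             (⟦⟧-mono (Fin.all? (λ u → placed? u (f u))) (isHomomorphism? B (graph k) f)
               (placed⇒hom f)))) ⟩
      ∑ᶠ s (homIndicator k) ℕ.* cs ℕ.^ sum (λ u → ⟦ touched? u ⟧)
        ≡⟨ cong (ℕ._* cs ℕ.^ sum (λ u → ⟦ touched? u ⟧)) (sym (hom≡∑ᶠ B (graph k))) ⟩
      H k ℕ.* cs ℕ.^ sum (λ u → ⟦ touched? u ⟧) ∎
      where open ℕ.≤-Reasoning

    -- As fewer than 2 e(B) vertices are touched, the exponent of `cs` in `H-end-touched` leaves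
    -- room for one more factor `cs`, which pays for e(B)^e(B).
    H-end : ∀ {x y z} → x ⟶ y → y ⟶ z → e B ℕ.^ e B ℕ.* n ℕ.^ s ℕ.≤ H k ℕ.* (cs ℕ.* cs) ℕ.^ e B
    H-end x⟶y y⟶z = begin
      e B ℕ.^ e B ℕ.* n ℕ.^ s
        ≤⟨ ℕ.*-mono-≤ eᵉ≤cs H-end-touched ⟩
      cs ℕ.* (H k ℕ.* cs ℕ.^ T)
        ≡⟨ solveℕ 3 (λ a h b → a ⊛ (h ⊛ b) ⊜ h ⊛ (a ⊛ b)) refl cs (H k) (cs ℕ.^ T) ⟩
      H k ℕ.* cs ℕ.^ suc T
        ≤⟨ ℕ.*-monoʳ-≤ (H k) (ℕ.^-monoʳ-≤ cs (touched-count x⟶y y⟶z)) ⟩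
      H k ℕ.* cs ℕ.^ (e B ℕ.+ e B)
        ≡⟨ cong (H k ℕ.*_) (sym (square-^ cs (e B))) ⟩
      H k ℕ.* (cs ℕ.* cs) ℕ.^ e B ∎
      where
      open ℕ.≤-Reasoning
      T : ℕ
      T = sum (λ u → ⟦ touched? u ⟧)
      eᵉ≤cs : e B ℕ.^ e B ℕ.≤ cs
      eᵉ≤cs = ℕ.≤-trans (ℕ.m≤n+m (e B ℕ.^ e B) (2 ℕ.+ e B ℕ.* 2)) (ℕ.m≤m*n c s)

-- Excluding directed paths of length two

within-gap : ∀ {a b d ε} → b ℚ.≤ a → a ℚ.≤ b ℚ.+ d → d ℚ.≤ ε → ℚ.∣ a ℚ.- b ∣ ℚ.≤ ε
within-gap {a} {b} {d} {ε} b≤a a≤b+d d≤ε = subst (ℚ._≤ ε) (sym (ℚ.0≤p⇒∣p∣≡p (≤⇒0≤gap b≤a)))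
  (≤-from-gap _ (0≤-+ (≤⇒0≤gap a≤b+d) (≤⇒0≤gap d≤ε))
    (solve 4 (λ a b d ε → ε := (a :- b) :+ (((b :+ d) :- a) :+ (ε :- d))) refl a b d ε))

squeeze : ∀ (f : ℕ → ℚ) l s → (∀ m → l ℚ.≤ f m × f m ℚ.≤ l ℚ.+ + s ℚ./ suc m) → f ⟶ℚ l
squeeze f l s bounds ε 0<ε =
  let M , small = reciprocals-vanish s ε 0<ε in
  M , λ m M≤m → within-gap (proj₁ (bounds m)) (proj₂ (bounds m)) (small m M≤m)

module _ (B : OrientedGraph) where
  open OrientedGraph B renaming (order to s)
  open Interpolation B

  no-directed-2-path : DirectedForcing B → ∀ {x y z} → x ⟶ y → ¬ y ⟶ z
  no-directed-2-path forcing {x} {y} {z} x⟶y y⟶z =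
    -- The edge density p/2 = e(B)/(cs)² depends neither on the blow-up factor nor on `j`. The block
    -- of length 1/c is copy 0.
    block-obstructs-forcing B {p} {+ 1 ℚ./ c} (/-positive (e B ℕ.* 2) (cs ℕ.* cs)) p≤1
      (/-positive 1 c) (/-mono-≤ 1 c 1 1 (ℕ.s≤s ℕ.z≤n))
      sequence edge-density B-density copy-0-independent forcing
    where
    instance
      e≢0 : ℕ.NonZero (e B)
      e≢0 = ℕ.>-nonZero (subst (1 ℕ.≤_) (sym (e≡∑∑ B))
        (ℕ.≤-trans (outdegree≥1 x⟶y) (term≤sum outdegree x)))
      e2≢0 : ℕ.NonZero (e B ℕ.* 2)
      e2≢0 = ℕ.m*n≢0 (e B) 2
      cs²ᵉ≢0 : ℕ.NonZero ((cs ℕ.* cs) ℕ.^ e B)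
      cs²ᵉ≢0 = ℕ.m^n≢0 (cs ℕ.* cs) (e B)
      cs²2≢0 : ℕ.NonZero (cs ℕ.* cs ℕ.* 2)
      cs²2≢0 = ℕ.m*n≢0 (cs ℕ.* cs) 2

    p θ : ℚ
    p = + (e B ℕ.* 2) ℚ./ (cs ℕ.* cs)
    θ = + (e B ℕ.^ e B) ℚ./ ((cs ℕ.* cs) ℕ.^ e B)

    p≤1 : p ℚ.≤ 1ℚ
    p≤1 = /-mono-≤ (e B ℕ.* 2) (cs ℕ.* cs) 1 1 (begin
      e B ℕ.* 2 ℕ.* 1  ≡⟨ ℕ.*-identityʳ (e B ℕ.* 2) ⟩
      e B ℕ.* 2        ≤⟨ ℕ.≤-trans (ℕ.m≤m+n (e B ℕ.* 2) (e B ℕ.^ e B)) (ℕ.m≤n+m c′ 2) ⟩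
      c                ≤⟨ ℕ.m≤m*n c s ⟩
      cs               ≤⟨ ℕ.m≤m*n cs cs ⟩
      cs ℕ.* cs        ≡⟨ sym (ℕ.*-identityˡ (cs ℕ.* cs)) ⟩
      1 ℕ.* (cs ℕ.* cs) ∎)
      where open ℕ.≤-Reasoning

    p½ : p ℚ.* ½ ≡ + e B ℚ./ (cs ℕ.* cs)
    p½ = trans (/-* (e B ℕ.* 2) (cs ℕ.* cs) 1 2)
      (/-≡ (e B ℕ.* 2 ℕ.* 1) (cs ℕ.* cs ℕ.* 2) (e B) (cs ℕ.* cs)
      (solveℕ 2 (λ e q → e ⊛ lit 2 ⊛ lit 1 ⊛ q ⊜ e ⊛ (q ⊛ lit 2)) refl (e B) (cs ℕ.* cs)))

    p½^e≡θ : (p ℚ.* ½) ^ℚ e B ≡ θ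
    p½^e≡θ = trans (cong (_^ℚ e B) p½) (/-^ (e B) (cs ℕ.* cs) (e B))

    0≤ratio : ∀ m d .{{_ : ℕ.NonZero d}} → 0ℚ ℚ.≤ + m ℚ./ d
    0≤ratio m d = ℚ.nonNegative⁻¹ (+ m ℚ./ d) {{ℚ.normalize-nonNeg m d}}

    density-step : ∀ m j → homDensity B (graph (suc m) (suc j)) ℚ.≤
      homDensity B (graph (suc m) j) ℚ.+ + s ℚ./ suc m
    density-step m j = homDensity-increment B (graph (suc m) j) (graph (suc m) (suc j)) refl
      s (suc m) (H-step (suc m) j)

    density-start : ∀ m → homDensity B (graph (suc m) 0) ℚ.≤ θ
    density-start m = homDensity≤ratio B (graph (suc m) 0) (e B ℕ.^ e B) ((cs ℕ.* cs) ℕ.^ e B)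
      (subst (λ h → h ℕ.* (cs ℕ.* cs) ℕ.^ e B ℕ.≤ e B ℕ.^ e B ℕ.* n (suc m) ℕ.^ s)
        (sym (H-start (suc m) x⟶y y⟶z)) ℕ.z≤n)

    density-end : ∀ m → θ ℚ.≤ homDensity B (graph (suc m) (suc m))
    density-end m = ratio≤homDensity B (graph (suc m) (suc m))
      (e B ℕ.^ e B) ((cs ℕ.* cs) ℕ.^ e B) (H-end (suc m) x⟶y y⟶z)

    -- Only the two bounds at the crossing index are used; opacity keeps the index from being
    -- evaluated by comparing densities.
    opaque
      crossing : ∀ m → ∃[ j ] θ ℚ.≤ homDensity B (graph (suc m) j) ×
        homDensity B (graph (suc m) j) ℚ.≤ θ ℚ.+ + s ℚ./ suc m
      crossing m = discrete-IVT (λ j → homDensity B (graph (suc m) j))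
        (density-step m) (density-start m) (0≤ratio s (suc m)) (suc m) (density-end m)

    sequence : ℕ → OrientedGraph
    sequence m = graph (suc m) (proj₁ (crossing m))

    edge-density : ∀ m → homDensity K⃗₂ (sequence m) ≡ p ℚ.* ½
    edge-density m = trans (homDensity≡ratio K⃗₂ (sequence m) (e B) (cs ℕ.* cs) (begin
        hom K⃗₂ (sequence m) ℕ.* (cs ℕ.* cs)
          ≡⟨ cong (ℕ._* (cs ℕ.* cs)) (edge-count k′ (proj₁ (crossing m))) ⟩
        e B ℕ.* (k′ ℕ.* k′) ℕ.* (cs ℕ.* cs)
          ≡⟨ solveℕ 4 (λ e k c s → e ⊛ (k ⊛ k) ⊛ (c ⊛ s ⊛ (c ⊛ s)) ⊜
               e ⊛ (c ⊛ (s ⊛ k) ⊛ (c ⊛ (s ⊛ k) ⊛ lit 1))) refl (e B) k′ c s ⟩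
        e B ℕ.* n k′ ℕ.^ 2 ∎)) (sym p½)
      where
      open ≡-Reasoning
      k′ : ℕ
      k′ = suc m

    B-density : (λ m → homDensity B (sequence m)) ⟶ℚ (p ℚ.* ½) ^ℚ e B
    B-density = subst ((λ m → homDensity B (sequence m)) ⟶ℚ_) (sym p½^e≡θ)
      (squeeze (λ m → homDensity B (sequence m)) θ s (λ m → proj₂ (crossing m)))

    -- Every edge has its tail in copy 1, whose vertices are numbered from s · k′ = n/c onwards.
    copy-0-independent : ∀ m → SpansNoEdges (OrientedGraph.digraph (sequence m)) (+ 1 ℚ./ c)
    copy-0-independent m i _ i<1/c _ (copy≡1 , _) = ℚ.<-irrefl refl (ℚ.<-≤-trans i<1/c
      (/-mono-≤ 1 c (toℕ i) (n k′) {{_}} {{n≢0 k′}} (begin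
        1 ℕ.* n k′
          ≡⟨ solveℕ 2 (λ c a → lit 1 ⊛ (c ⊛ a) ⊜ a ⊛ lit 1 ⊛ c) refl c (s ℕ.* k′) ⟩
        s ℕ.* k′ ℕ.* 1 ℕ.* c
          ≡⟨ cong (λ a → s ℕ.* k′ ℕ.* toℕ a ℕ.* c) (sym copy≡1) ⟩
        s ℕ.* k′ ℕ.* toℕ (copy c s k′ i) ℕ.* c
          ≤⟨ ℕ.*-monoˡ-≤ c (copy-lower-bound c s k′ i) ⟩
        toℕ i ℕ.* c ∎)))
      where
      open ℕ.≤-Reasoning
      k′ : ℕ
      k′ = suc m

  -- Vertices with an outgoing edge go to the tail of `K⃗₂`, all others to its head. The head of an
  -- edge has no outgoing edge, as there is no directed path of length two.
  forcing⇒homomorphic : DirectedForcing B → HomomorphicTo B K⃗₂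
  forcing⇒homomorphic forcing = side , λ x y x⟶y →
    cong (λ b → if b then zero else suc zero) (dec-true (leaves? x) (y , x⟶y)) ,
    cong (λ b → if b then zero else suc zero) (dec-false (leaves? y) λ (z , y⟶z) →
      no-directed-2-path forcing x⟶y y⟶z)
    where
    leaves? : ∀ u → Dec (∃[ w ] u ⟶ w)
    leaves? u = Fin.any? (u ⟶?_)
    side : Fin s → Fin 2
    side u = if does (leaves? u) then zero else suc zero

theorem1p6 : (B : OrientedGraph) → DirectedForcing B → HomomorphicTo B K⃗₂ × Cycle (underlying B)
theorem1p6 B forcing = forcing⇒homomorphic B forcing , forcing⇒cycle B forcing
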